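{- Let $p=\tfrac23$, $q=\tfrac13$, and let $g_0(z),g_1(z),g_2(z),\dots$ and $g_\beta(z)$ be the formal power series in $z$ uniquely determined by $$g_0=1+zg_\beta+qzg_2,\qquad g_\beta=qzg_1,\qquad g_1=zg_0+qzg_3,\qquad g_i=pzg_{i-1}+qzg_{i+2}\ (i\ge2).$$ Put $G(u,z)=\sum_{i\ge0}u^ig_i(z)$, write $V=uz$, $x=z^3$, and let $t=t(x)$ be the formal power series with $t(0)=0$ satisfying $x=\tfrac{27}{4}t(1-t)^2$. Then: (i) $$G(u,z)=2\,\frac{2+\frac{2}{3(1-t)}V}{(1-3t)(4-3t)}\cdot\frac{1}{1-\frac{2}{3(1-t)}V};$$ in particular, written in the variable $V$, only powers of $z$ that are multiples of $3$ appear. (ii) For $j\ge1$, $$[V^j]G=\frac{6}{(1-3t)(4-3t)}\Big(\frac23\cdot\frac1{1-t}\Big)^j,\qquad [u^j]G=z^j\frac{6}{(1-3t)(4-3t)}\Big(\frac23\cdot\frac1{1-t}\Big)^j.$$ (iii) For $j\ge1$ and $N\ge0$, $$[z^{j+3N}u^j]G(u,z)=\sum_{i=0}^N\frac{2^{2i+j-1}}{3^{2N+i+j-1}}\binom{2N+j+i}{i}.$$ (iv) For $N\ge0$, $$[z^{3N}]g_0=\sum_{i=0}^N\frac{2^{2i}}{3^{2N+i}}\binom{2N+i}{i},\qquad [z^{3N+2}]g_\beta=\frac13[z^{3N+1}]g_1=\sum_{i=0}^N\frac{2^{2i}}{3^{2N+i+1}}\binom{2N+1+i}{i}.$$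
   Context: Dual online bin-packing model: bins have size 1; at each step either a single item of size $\tfrac23$ arrives (probability $p=\tfrac23$) or a double-pack of two items of size $\tfrac13$ arrives (probability $q=\tfrac13$). State $i\ge0$ means $i$ boxes filled to $\tfrac23$; $\beta$ is an exceptional state (one box filled to $\tfrac13$). The coefficient of $z^n$ in $g_i(z)$ (resp. $g_\beta(z)$) is the probability that $n$ random steps starting from state $0$ lead to state $i$ (resp. $\beta$); these series are defined by the recursion in the claim. $[\cdot]$ denotes coefficient extraction. -}

module Defs where

open import Algebra.Bundles.Raw using (RawRing)
open import Algebra.Core using (Op₁)
import Algebra.Definitions.RawSemiring as RawSemiringDefs
open import Data.Fin.Base using (toℕ)
open import Data.Integer.Base using (+_)
open import Data.Nat.Base using (ℕ; zero; suc; _∸_)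
import Data.Nat.Base as ℕ
open import Data.Nat.Divisibility using (_∣?_; quotient)
open import Data.Nat.Properties using (m^n≢0)
open import Data.Rational.Base using (ℚ; 0ℚ; 1ℚ; _/_; 1/_; ≢-nonZero; +-*-rawRing)
open import Data.Rational.Properties using (_≟_)
open import Relation.Binary.PropositionalEquality.Core using (_≡_)
open import Relation.Nullary.Decidable.Core using (yes; no)

module FiniteSum {c ℓ} (R : RawRing c ℓ) where
  open RawRing R

  ∑≤ : ℕ → (ℕ → Carrier) → Carrier
  ∑≤ n f = RawSemiringDefs.sum rawSemiring {suc n} (λ k → f (toℕ k))

  syntax ∑≤ n (λ k → e) = ∑[ k ≤ n ] e

-- Formal power series over R, as coefficient sequences.  The argument `inv`
-- is a total function giving inverses of units of R; its values at non-units
-- are irrelevant.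
module PowerSeries {c ℓ} (R : RawRing c ℓ) (inv : Op₁ (RawRing.Carrier R)) where
  private module R = RawRing R
  open FiniteSum R

  Series : Set c
  Series = ℕ → R.Carrier

  κ : R.Carrier → Series
  κ a zero    = a
  κ a (suc _) = R.0#

  X : Series
  X 1 = R.1#
  X _ = R.0#

  rawRing : RawRing c ℓ
  rawRing = record
    { Carrier = Series
    ; _≈_     = λ f g → ∀ n → f n R.≈ g n
    ; _+_     = λ f g n → f n R.+ g n
    ; _*_     = λ f g n → ∑[ k ≤ n ] (f k R.* g (n ∸ k))
    ; -_      = λ f n → R.- f n
    ; 0#      = κ R.0#
    ; 1#      = κ R.1#
    }

  open RawRing rawRing public using (_≈_; _+_; _*_; -_; 0#; 1#)
  open RawSemiringDefs (RawRing.rawSemiring rawRing) public using (_^_)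

  infixl 6 _-_
  _-_ : Series → Series → Series
  f - g = f + (- g)

  -- With a = 1/f(0), the series 1 - a f has zero constant term, and
  -- 1/f = a Σₖ (1 - a f)ᵏ, where the terms with k > n do not contribute to
  -- the n-th coefficient.
  infix 9 _⁻¹
  _⁻¹ : Series → Series
  (f ⁻¹) n = a R.* (∑[ k ≤ n ] ((1# - κ a * f) ^ k) n)
    where a = inv (f 0)

recip : ℚ → ℚ
recip r with r ≟ 0ℚ
... | yes _   = 0ℚ
... | no  r≢0 = 1/_ r {{≢-nonZero r≢0}}

-- Univariate series are used with the variable called z or x, and bivariate
-- series with the outer variable called u or V.
module ℚ⟦z⟧ = PowerSeries +-*-rawRing recip
module ℚ⟦z⟧⟦u⟧ = PowerSeries ℚ⟦z⟧.rawRing ℚ⟦z⟧._⁻¹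

open FiniteSum +-*-rawRing public

p q : ℚ
p = + 2 / 3
q = + 1 / 3

record IsSolution (g : ℕ → ℚ⟦z⟧.Series) (gβ : ℚ⟦z⟧.Series) : Set where
  open ℚ⟦z⟧
  private z = X
  field
    eq-0 : g 0 ≈ 1# + z * gβ + κ q * z * g 2
    eq-β : gβ  ≈ κ q * z * g 1
    eq-1 : g 1 ≈ z * g 0 + κ q * z * g 3
    eq-i : ∀ i → g (2 ℕ.+ i) ≈ κ p * z * g (1 ℕ.+ i) + κ q * z * g (4 ℕ.+ i)

-- G(u,z) = Σᵢ uⁱ gᵢ(z)
genFun : (ℕ → ℚ⟦z⟧.Series) → ℚ⟦z⟧⟦u⟧.Series
genFun g i = g i

record IsT (t : ℚ⟦z⟧.Series) : Set where
  open ℚ⟦z⟧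
  private x = X
  field
    constant : t 0 ≡ 0ℚ
    equation : x ≈ κ (+ 27 / 4) * t * (1# - t) ^ 2

-- f(x) ↦ f(z³)
infix 9 _∘z³
_∘z³ : ℚ⟦z⟧.Series → ℚ⟦z⟧.Series
(f ∘z³) n with 3 ∣? n
... | yes 3∣n = f (quotient 3∣n)
... | no  _   = 0ℚ

-- H(V,z) ↦ H(uz,z), since Σⱼ Vʲ Hⱼ(z) becomes Σⱼ uʲ zʲ Hⱼ(z).  A series G(u,z)
-- "written in the variable V" is the H with G(u,z) = H(uz,z), and [Vʲ]G is Hⱼ.
infix 9 _[V≔uz]
_[V≔uz] : ℚ⟦z⟧⟦u⟧.Series → ℚ⟦z⟧⟦u⟧.Series
(H [V≔uz]) j = z ^ j * H j
  where open ℚ⟦z⟧ renaming (X to z)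

infix 8 2^_/3^_
2^_/3^_ : ℕ → ℕ → ℚ
2^ a /3^ b = _/_ (+ (2 ℕ.^ a)) (3 ℕ.^ b) {{m^n≢0 3 b}}

{-# OPTIONS --safe #-}
-- The equations for g determine the coefficients one power of z at a time, so
-- their solution is unique and every claim reduces to checking a candidate.
-- For (i) and (ii) the candidate is geometric: gⱼ = zʲ (6/d) rʲ for j ≥ 1, where
-- r = 2/(3(1-t)) satisfies z³ r³ = 3r - 2, the cubic equation for t.  For (iii)
-- and (iv) no Lagrange inversion is needed: with y = 4/3 and
-- U m n = Σ_{i ≤ n} yⁱ (m+i choose i), Pascal's rule gives
-- U (m+1) (n+1) = U m (n+1) + y U (m+1) n, which is the recursion for gⱼ, j ≥ 1,
-- while the equation for g₀ amounts to
-- U (2n+2) (n+1) = 3 U (2n+1) n + 2 U (2n+2) n.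
module Submission where

open import Algebra.Bundles using (CommutativeRing)
open import Algebra.Core using (Op₁)
import Algebra.Properties.CommutativeSemigroup as CommutativeSemigroupProperties
import Algebra.Properties.Ring as RingProperties
import Algebra.Properties.Semiring.Exp as SemiringExp
import Algebra.Solver.Ring as RingSolver
open import Algebra.Solver.Ring.AlmostCommutativeRing using (fromCommutativeRing; _-Raw-AlmostCommutative⟶_)
open import Data.Integer.Base using (+_)
import Data.Integer.Base as ℤ
import Data.Integer.Properties as ℤ
open import Data.Maybe.Base using (Maybe; just; nothing)
open import Data.Nat.Base using (ℕ; zero; suc; _∸_; _≤_; _<_; z≤n; s≤s)
import Data.Nat.Base as ℕ
open import Data.Nat.Combinatorics using (_C_; nCk+nC[k+1]≡[n+1]C[k+1]; nC1≡n)
open import Data.Nat.Divisibility using (_∣_; _∣?_; divides; quotient; ∣m+n∣m⇒∣n; ∣m∣n⇒∣m+n; ∣-refl)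
import Data.Nat.Properties as ℕ
open import Data.Nat.Tactic.RingSolver using (solve-∀)
open import Data.Product using (_×_; _,_; ∃; ∃!; proj₁; proj₂; uncurry)
open import Data.Product.Relation.Binary.Pointwise.NonDependent using (Pointwise)
open import Data.Rational.Base using (ℚ; 0ℚ; 1ℚ; _/_; fromℚᵘ; +-*-rawRing) renaming (_*_ to _·_; _+_ to _⊕_)
import Data.Rational.Base as ℚ
import Data.Rational.Properties as ℚ
open import Data.Rational.Solver using (module +-*-Solver)
import Data.Rational.Unnormalised.Base as ℚᵘ
import Data.Rational.Unnormalised.Properties as ℚᵘ
open import Data.Sum.Base using (inj₁; inj₂)
open import Defs using (module FiniteSum; module PowerSeries)
open import Function.Base using (_∘_)
open import Level using (_⊔_)
open import Relation.Binary.PropositionalEquality.Core using (_≡_; _≢_; cong; cong₂; subst)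
open import Relation.Binary.PropositionalEquality using (module ≡-Reasoning)
import Relation.Binary.Reasoning.Setoid as SetoidReasoning
open import Relation.Nullary using (yes; no; contradiction)

-- The geometric candidate comes from the ansatz gⱼ = zʲ c rʲ. The interior recursion becomes r = p
-- + q z³ r³, and putting r = 2/(3(1-t)) turns this into the defining equation of t at x = z³. The
-- boundary equations then fix the constants: the one for g₁ forces g₀ = p c, and the one for g₀
-- becomes c (2 - z³ r - z³ r²) = 3. Since z³ r² = 3t and z³ r = (9/2) t (1-t), the bracket is
-- (1-3t)(4-3t)/2, so c = 6/d with d = (1-3t)(4-3t).

-- Formal power series over a commutative ring: ring laws, fixed points, inverses.

module SeriesRing {c ℓ} (R : CommutativeRing c ℓ) (inv : Op₁ (CommutativeRing.Carrier R)) where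
  open PowerSeries (CommutativeRing.rawRing R) inv public
  open FiniteSum (CommutativeRing.rawRing R)
  private
    module R = CommutativeRing R
    module RP = RingProperties R.ring
    module +CS = CommutativeSemigroupProperties R.+-commutativeSemigroup
    open SetoidReasoning R.setoid

  tail : Series → Series
  tail f n = f (suc n)

  infix 4 _≈[_]_
  _≈[_]_ : Series → ℕ → Series → Set ℓ
  f ≈[ n ] g = ∀ k → k ≤ n → f k R.≈ g k

  -- The induction rests on `(f * g) (suc n)` unfolding definitionally to
  -- `f 0 R.* g (suc n) R.+ (tail f * g) n`; products are taken apart in this way throughout. The
  -- version bounded by degree is what contractions need.
  *-local : ∀ n f f′ g g′ → f ≈[ n ] f′ → g ≈[ n ] g′ → (f * g) n R.≈ (f′ * g′) n
  *-local zero    f f′ g g′ f≈ g≈ = R.+-congʳ (R.*-cong (f≈ 0 z≤n) (g≈ 0 z≤n))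
  *-local (suc n) f f′ g g′ f≈ g≈ = R.+-cong
    (R.*-cong (f≈ 0 z≤n) (g≈ (suc n) ℕ.≤-refl))
    (*-local n (tail f) (tail f′) g g′ (λ k k≤n → f≈ (suc k) (s≤s k≤n)) (λ k k≤n → g≈ k (ℕ.m≤n⇒m≤1+n k≤n)))

  *-cong : ∀ {f f′ g g′} → f ≈ f′ → g ≈ g′ → f * g ≈ f′ * g′
  *-cong {f} {f′} {g} {g′} f≈ g≈ n = *-local n f f′ g g′ (λ k _ → f≈ k) (λ k _ → g≈ k)

  *-distribʳ : ∀ h f g → (f + g) * h ≈ f * h + g * h
  *-distribʳ h f g zero = begin
    (f 0 R.+ g 0) R.* h 0 R.+ R.0#                    ≈⟨ R.+-identityʳ _ ⟩
    (f 0 R.+ g 0) R.* h 0                             ≈⟨ R.distribʳ (h 0) (f 0) (g 0) ⟩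
    f 0 R.* h 0 R.+ g 0 R.* h 0                       ≈⟨ R.+-cong (R.+-identityʳ _) (R.+-identityʳ _) ⟨
    (f 0 R.* h 0 R.+ R.0#) R.+ (g 0 R.* h 0 R.+ R.0#) ∎
  *-distribʳ h f g (suc n) = begin
    (f 0 R.+ g 0) R.* h (suc n) R.+ ((tail f + tail g) * h) n
      ≈⟨ R.+-cong (R.distribʳ _ _ _) (*-distribʳ h (tail f) (tail g) n) ⟩
    (f 0 R.* h (suc n) R.+ g 0 R.* h (suc n)) R.+ ((tail f * h) n R.+ (tail g * h) n)
      ≈⟨ +CS.interchange _ _ _ _ ⟩
    (f 0 R.* h (suc n) R.+ (tail f * h) n) R.+ (g 0 R.* h (suc n) R.+ (tail g * h) n) ∎

  *-scaleˡ : ∀ a f g n → ((λ k → a R.* f k) * g) n R.≈ a R.* (f * g) n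
  *-scaleˡ a f g zero = begin
    a R.* f 0 R.* g 0 R.+ R.0#   ≈⟨ R.+-identityʳ _ ⟩
    a R.* f 0 R.* g 0            ≈⟨ R.*-assoc _ _ _ ⟩
    a R.* (f 0 R.* g 0)          ≈⟨ R.*-congˡ (R.+-identityʳ _) ⟨
    a R.* (f 0 R.* g 0 R.+ R.0#) ∎
  *-scaleˡ a f g (suc n) = begin
    a R.* f 0 R.* g (suc n) R.+ ((λ k → a R.* tail f k) * g) n
      ≈⟨ R.+-cong (R.*-assoc _ _ _) (*-scaleˡ a (tail f) g n) ⟩
    a R.* (f 0 R.* g (suc n)) R.+ a R.* (tail f * g) n
      ≈⟨ R.distribˡ _ _ _ ⟨
    a R.* (f 0 R.* g (suc n) R.+ (tail f * g) n) ∎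

  *-zeroˡ : ∀ g n → ((λ _ → R.0#) * g) n R.≈ R.0#
  *-zeroˡ g zero    = R.trans (R.+-identityʳ _) (R.zeroˡ _)
  *-zeroˡ g (suc n) = R.trans (R.+-cong (R.zeroˡ _) (*-zeroˡ g n)) (R.+-identityʳ _)

  *-κˡ : ∀ a f n → (κ a * f) n R.≈ a R.* f n
  *-κˡ a f zero    = R.+-identityʳ _
  *-κˡ a f (suc n) = R.trans (R.+-congˡ (*-zeroˡ f n)) (R.+-identityʳ _)

  -- Products unfold at the first term of the left factor. Splitting off the last term instead gives
  -- the mirror image, which makes commutativity a direct induction.
  *-sucʳ : ∀ f g n → (f * g) (suc n) R.≈ (f * tail g) n R.+ f (suc n) R.* g 0
  *-sucʳ f g zero    = R.+-cong (R.sym (R.+-identityʳ _)) (R.+-identityʳ _)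
  *-sucʳ f g (suc n) = R.trans (R.+-congˡ (*-sucʳ (tail f) g n)) (R.sym (R.+-assoc _ _ _))

  *-comm : ∀ f g → f * g ≈ g * f
  *-comm f g zero    = R.+-congʳ (R.*-comm _ _)
  *-comm f g (suc n) = begin
    f 0 R.* g (suc n) R.+ (tail f * g) n ≈⟨ R.+-cong (R.*-comm _ _) (*-comm (tail f) g n) ⟩
    g (suc n) R.* f 0 R.+ (g * tail f) n ≈⟨ R.+-comm _ _ ⟩
    (g * tail f) n R.+ g (suc n) R.* f 0 ≈⟨ *-sucʳ g f n ⟨
    (g * f) (suc n)                      ∎

  *-assoc : ∀ f g h → (f * g) * h ≈ f * (g * h)
  *-assoc f g h zero = R.+-congʳ (begin
    (f 0 R.* g 0 R.+ R.0#) R.* h 0 ≈⟨ R.*-congʳ (R.+-identityʳ _) ⟩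
    f 0 R.* g 0 R.* h 0            ≈⟨ R.*-assoc _ _ _ ⟩
    f 0 R.* (g 0 R.* h 0)          ≈⟨ R.*-congˡ (R.+-identityʳ _) ⟨
    f 0 R.* (g 0 R.* h 0 R.+ R.0#) ∎)
  *-assoc f g h (suc n) = begin
    -- By definition, `tail (f * g)` is `f 0` times `tail g` plus `tail f * g`.
    (f 0 R.* g 0 R.+ R.0#) R.* h (suc n) R.+ (((λ k → f 0 R.* tail g k) + tail f * g) * h) n
      ≈⟨ R.+-cong (R.*-congʳ (R.+-identityʳ _)) (*-distribʳ h (λ k → f 0 R.* tail g k) (tail f * g) n) ⟩
    f 0 R.* g 0 R.* h (suc n) R.+ (((λ k → f 0 R.* tail g k) * h) n R.+ ((tail f * g) * h) n)
      ≈⟨ R.+-cong (R.*-assoc _ _ _) (R.+-cong (*-scaleˡ (f 0) (tail g) h n) (*-assoc (tail f) g h n)) ⟩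
    f 0 R.* (g 0 R.* h (suc n)) R.+ (f 0 R.* (tail g * h) n R.+ (tail f * (g * h)) n)
      ≈⟨ R.+-assoc _ _ _ ⟨
    f 0 R.* (g 0 R.* h (suc n)) R.+ f 0 R.* (tail g * h) n R.+ (tail f * (g * h)) n
      ≈⟨ R.+-congʳ (R.distribˡ _ _ _) ⟨
    f 0 R.* (g 0 R.* h (suc n) R.+ (tail g * h) n) R.+ (tail f * (g * h)) n ∎

  *-identityˡ : ∀ f → 1# * f ≈ f
  *-identityˡ f n = R.trans (*-κˡ R.1# f n) (R.*-identityˡ _)

  0#-coeff : ∀ n → 0# n R.≈ R.0#
  0#-coeff zero    = R.refl
  0#-coeff (suc n) = R.refl

  commutativeRing : CommutativeRing c ℓ
  commutativeRing = record
    { Carrier = Series ; _≈_ = _≈_ ; _+_ = _+_ ; _*_ = _*_ ; -_ = -_ ; 0# = 0# ; 1# = 1#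
    ; isCommutativeRing = record
      { isRing = record
        { +-isAbelianGroup = record
          { isGroup = record
            { isMonoid = record
              { isSemigroup = record
                { isMagma = record
                  { isEquivalence = record
                    { refl  = λ n → R.refl
                    ; sym   = λ f≈g n → R.sym (f≈g n)
                    ; trans = λ f≈g g≈h n → R.trans (f≈g n) (g≈h n)
                    }
                  ; ∙-cong = λ f≈ g≈ n → R.+-cong (f≈ n) (g≈ n)
                  }
                ; assoc = λ f g h n → R.+-assoc _ _ _
                }
              ; identity = (λ f n → R.trans (R.+-congʳ (0#-coeff n)) (R.+-identityˡ _))
                         , (λ f n → R.trans (R.+-congˡ (0#-coeff n)) (R.+-identityʳ _))
              }
            ; inverse = (λ f n → R.trans (R.-‿inverseˡ _) (R.sym (0#-coeff n)))
                      , (λ f n → R.trans (R.-‿inverseʳ _) (R.sym (0#-coeff n)))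
            ; ⁻¹-cong = λ f≈g n → R.-‿cong (f≈g n)
            }
          ; comm = λ f g n → R.+-comm _ _
          }
        ; *-cong = *-cong
        ; *-assoc = *-assoc
        ; *-identity = *-identityˡ , λ f n → R.trans (*-comm f 1# n) (*-identityˡ f n)
        ; distrib = (λ h f g n → R.trans (*-comm h (f + g) n) (R.trans (*-distribʳ h f g n) (R.+-cong (*-comm f h n) (*-comm g h n))))
                  , *-distribʳ
        }
      ; *-comm = *-comm
      }
    }

  private
    module S = CommutativeRing commutativeRing
    module SP = RingProperties S.ring
    module S≈ = SetoidReasoning S.setoid

  κ-cong : ∀ {a b} → a R.≈ b → κ a ≈ κ b
  κ-cong a≈b zero    = a≈b
  κ-cong a≈b (suc n) = R.refl

  κ-+ : ∀ a b → κ (a R.+ b) ≈ κ a + κ b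
  κ-+ a b zero    = R.refl
  κ-+ a b (suc n) = R.sym (R.+-identityʳ _)

  κ-* : ∀ a b → κ (a R.* b) ≈ κ a * κ b
  κ-* a b zero    = R.sym (R.+-identityʳ _)
  κ-* a b (suc n) = R.sym (R.trans (*-κˡ a (κ b) (suc n)) (R.zeroʳ a))

  κ-neg : ∀ a → κ (R.- a) ≈ - κ a
  κ-neg a zero    = R.refl
  κ-neg a (suc n) = R.sym RP.-0#≈0#

  X*-zero : ∀ f → (X * f) 0 R.≈ R.0#
  X*-zero f = R.trans (R.+-identityʳ _) (R.zeroˡ _)

  X*-suc : ∀ f n → (X * f) (suc n) R.≈ f n
  X*-suc f n = begin
    R.0# R.* f (suc n) R.+ (tail X * f) n ≈⟨ R.+-cong (R.zeroˡ _) (*-cong {tail X} {1#} {f} {f} tail-X S.refl n) ⟩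
    R.0# R.+ (1# * f) n                   ≈⟨ R.+-identityˡ _ ⟩
    (1# * f) n                            ≈⟨ *-identityˡ f n ⟩
    f n                                   ∎
    where
    tail-X : tail X ≈ 1#
    tail-X zero    = R.refl
    tail-X (suc n) = R.refl

  X*-cancel : ∀ {f g} → X * f ≈ X * g → f ≈ g
  X*-cancel {f} {g} eq n = R.trans (R.sym (X*-suc f n)) (R.trans (eq (suc n)) (X*-suc g n))

  X^*-cancel : ∀ j {f g} → X ^ j * f ≈ X ^ j * g → f ≈ g
  X^*-cancel zero    eq = S.trans (S.sym (*-identityˡ _)) (S.trans eq (*-identityˡ _))
  X^*-cancel (suc j) {f} {g} eq = X^*-cancel j (X*-cancel
    (S.trans (S.sym (*-assoc X (X ^ j) f)) (S.trans eq (*-assoc X (X ^ j) g))))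

  ∑-cong : ∀ m {f g : ℕ → R.Carrier} → (∀ k → f k R.≈ g k) → ∑≤ m f R.≈ ∑≤ m g
  ∑-cong zero    f≈g = R.+-congʳ (f≈g 0)
  ∑-cong (suc m) f≈g = R.+-cong (f≈g 0) (∑-cong m (f≈g ∘ suc))

  -- Strict contraction for the X-adic metric: agreement below degree n improves to agreement up to
  -- n. Inverses and the series t are both built from fixed points of such maps.
  Contraction : (Series → Series) → Set (c ⊔ ℓ)
  Contraction Φ = ∀ f g n → (∀ k → k < n → f k R.≈ g k) → Φ f ≈[ n ] Φ g

  -- The fixed point of a contraction, with n-th coefficient read off its
  -- (n+1)-st iterate.
  module FixedPoint
    (Φ : Series → Series)
    (contracts : Contraction Φ)
    where

    iterate : ℕ → Series
    iterate zero    = 0#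
    iterate (suc m) = Φ (iterate m)

    fix : Series
    fix n = iterate (suc n) n

    iterate-stable : ∀ m k → k < m → iterate m k R.≈ iterate (suc m) k
    iterate-stable (suc m) k (s≤s k≤m) = contracts (iterate m) (iterate (suc m)) m (iterate-stable m) k k≤m

    fix-iterate : ∀ m k → k < m → fix k R.≈ iterate m k
    fix-iterate (suc m) k (s≤s k≤m) with ℕ.m≤n⇒m<n∨m≡n k≤m
    ... | inj₁ k<m  = R.trans (fix-iterate m k k<m) (iterate-stable m k k<m)
    ... | inj₂ _≡_.refl = R.refl

    fix-fixed : fix ≈ Φ fix
    fix-fixed n = contracts (iterate n) fix n (λ k k<n → R.sym (fix-iterate n k k<n)) n ℕ.≤-refl

  +-contracts : ∀ h Φ → Contraction Φ → Contraction (λ f → h + Φ f)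
  +-contracts h Φ contracts f g n f≈g k k≤n = R.+-congˡ (contracts f g n f≈g k k≤n)

  -- The only term of the n-th coefficient of `w * f` that reads `f n` has the factor `w 0`, which
  -- vanishes.
  *-contracts : ∀ w → w 0 R.≈ R.0# → Contraction (w *_)
  *-contracts w w₀≈0 f g n f≈g = λ where
      zero    _   → R.+-congʳ (w₀*-constant (f 0) (g 0))
      (suc k) k<n → R.+-cong (w₀*-constant (f (suc k)) (g (suc k)))
        (*-local k (tail w) (tail w) f g (λ _ _ → R.refl) (λ l l≤k → f≈g l (ℕ.≤-<-trans l≤k k<n)))
    where
    w₀*-constant : ∀ a b → w 0 R.* a R.≈ w 0 R.* b
    w₀*-constant a b = begin
      w 0 R.* a   ≈⟨ R.*-congʳ w₀≈0 ⟩
      R.0# R.* a  ≈⟨ R.zeroˡ a ⟩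
      R.0#        ≈⟨ R.zeroˡ b ⟨
      R.0# R.* b  ≈⟨ R.*-congʳ w₀≈0 ⟨
      w 0 R.* b   ∎

  module _ (f : Series) (invertible : f 0 R.* inv (f 0) R.≈ R.1#) where
    private
      a = inv (f 0)

      w : Series
      w = 1# - κ a * f

      w₀≈0 : w 0 R.≈ R.0#
      w₀≈0 = begin
        R.1# R.- (a R.* f 0 R.+ R.0#) ≈⟨ R.+-congˡ (R.-‿cong (R.trans (R.+-identityʳ _) (R.trans (R.*-comm _ _) invertible))) ⟩
        R.1# R.- R.1#                 ≈⟨ R.-‿inverseʳ _ ⟩
        R.0#                          ∎

      Φ : Series → Series
      Φ y = 1# + w * y

      open FixedPoint Φ (+-contracts 1# (w *_) (*-contracts w w₀≈0))

      -- `iterate (suc m)` is the partial geometric sum in Horner form. Sums unfold from their first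
      -- term, so the factor `c` is there to absorb one `w` per induction step.
      ∑-powers : ∀ c m n → ∑[ k ≤ m ] (c * w ^ k) n R.≈ (c * iterate (suc m)) n
      ∑-powers c zero    n = begin
        (c * 1#) n R.+ R.0#     ≈⟨ R.+-identityʳ _ ⟩
        (c * 1#) n              ≈⟨ *-cong {c} S.refl (S.sym (S.trans (S.+-congˡ {1#} (S.zeroʳ w)) (S.+-identityʳ 1#))) n ⟩
        (c * (1# + w * 0#)) n   ∎
      ∑-powers c (suc m) n = begin
        (c * 1#) n R.+ ∑[ k ≤ m ] (c * (w * w ^ k)) n ≈⟨ R.+-congˡ (∑-cong m λ k → R.sym (*-assoc c w (w ^ k) n)) ⟩
        (c * 1#) n R.+ ∑[ k ≤ m ] (c * w * w ^ k) n   ≈⟨ R.+-congˡ (∑-powers (c * w) m n) ⟩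
        (c * 1#) n R.+ (c * w * iterate (suc m)) n    ≈⟨ R.+-congˡ (*-assoc c w (iterate (suc m)) n) ⟩
        (c * 1#) n R.+ (c * (w * iterate (suc m))) n  ≈⟨ S.distribˡ c 1# (w * iterate (suc m)) n ⟨
        (c * (1# + w * iterate (suc m))) n            ∎

      -- The cut-off `k ≤ n` in the definition of `_⁻¹` selects exactly the iterate from which `fix`
      -- takes its n-th coefficient.
      ⁻¹-fix : f ⁻¹ ≈ κ a * fix
      ⁻¹-fix n = begin
        a R.* (∑[ k ≤ n ] (w ^ k) n)        ≈⟨ R.*-congˡ (∑-cong n λ k → R.sym (*-identityˡ (w ^ k) n)) ⟩
        a R.* (∑[ k ≤ n ] (1# * w ^ k) n)   ≈⟨ R.*-congˡ (∑-powers 1# n n) ⟩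
        a R.* (1# * iterate (suc n)) n      ≈⟨ R.*-congˡ (*-identityˡ (iterate (suc n)) n) ⟩
        a R.* fix n                         ≈⟨ *-κˡ a fix n ⟨
        (κ a * fix) n                       ∎

    -- As `f * κ a` is 1 - w, this is the equation fix = 1 + w fix rearranged.
    ⁻¹-inverseʳ : f * f ⁻¹ ≈ 1#
    ⁻¹-inverseʳ = S≈.begin
      f * f ⁻¹               S≈.≈⟨ *-cong {f} S.refl ⁻¹-fix ⟩
      f * (κ a * fix)        S≈.≈⟨ *-assoc f (κ a) fix ⟨
      f * κ a * fix          S≈.≈⟨ S.*-congʳ {fix} κaf≈1-w ⟩
      (1# - w) * fix         S≈.≈⟨ *-distribʳ fix 1# (- w) ⟩
      1# * fix + - w * fix   S≈.≈⟨ S.+-cong {1# * fix} (S.trans (*-identityˡ fix) fix-fixed) (S.sym (SP.-‿distribˡ-* w fix)) ⟩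
      1# + w * fix - w * fix S≈.≈⟨ S.+-assoc 1# (w * fix) (- (w * fix)) ⟩
      1# + (w * fix - w * fix) S≈.≈⟨ S.+-congˡ {1#} (S.-‿inverseʳ (w * fix)) ⟩
      1# + 0#                S≈.≈⟨ S.+-identityʳ 1# ⟩
      1#                     S≈.∎
      where
      κaf≈1-w : f * κ a ≈ 1# - w
      κaf≈1-w = S≈.begin
        f * κ a                    S≈.≈⟨ *-comm f (κ a) ⟩
        κ a * f                    S≈.≈⟨ SP.-‿involutive (κ a * f) ⟨
        - - (κ a * f)              S≈.≈⟨ S.+-identityˡ (- - (κ a * f)) ⟨
        0# + - - (κ a * f)         S≈.≈⟨ S.+-congʳ { - - (κ a * f)} (S.-‿inverseʳ 1#) ⟨
        1# - 1# + - - (κ a * f)    S≈.≈⟨ S.+-assoc 1# (- 1#) (- - (κ a * f)) ⟩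
        1# + (- 1# + - - (κ a * f)) S≈.≈⟨ S.+-congˡ {1#} (SP.-‿+-comm 1# (- (κ a * f))) ⟩
        1# - w                     S≈.∎

  *-cancelˡ-invertible : ∀ f → f 0 R.* inv (f 0) R.≈ R.1# → ∀ {g h} → f * g ≈ f * h → g ≈ h
  *-cancelˡ-invertible f inv₀ {g} {h} eq = S≈.begin
    g              S≈.≈⟨ cancel g ⟨
    f ⁻¹ * (f * g) S≈.≈⟨ *-cong {f ⁻¹} S.refl eq ⟩
    f ⁻¹ * (f * h) S≈.≈⟨ cancel h ⟩
    h              S≈.∎
    where
    cancel : ∀ k → f ⁻¹ * (f * k) ≈ k
    cancel k = S.trans (S.sym (*-assoc (f ⁻¹) f k)) (S.trans (*-cong {g = k} (S.trans (*-comm (f ⁻¹) f) (⁻¹-inverseʳ f inv₀)) S.refl) (*-identityˡ k))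

open import Defs

-- Polynomial identities with rational constants.

-- The ring is abstract so that the solver never meets a convolution, and so that ℚ⟦z⟧ and ℚ⟦z⟧⟦u⟧
-- can share the module.
module RationalAlgebra {c ℓ} (A : CommutativeRing c ℓ)
  (morphism : +-*-rawRing -Raw-AlmostCommutative⟶ fromCommutativeRing A)
  where

  open CommutativeRing A
  open _-Raw-AlmostCommutative⟶_ morphism using () renaming (⟦_⟧ to κ)
  open SetoidReasoning setoid
  open SemiringExp semiring using (_^_)

  private
    κ-≟ : ∀ a b → Maybe (κ a ≈ κ b)
    κ-≟ a b with a ℚ.≟ b
    ... | yes a≡b = just (reflexive (cong κ a≡b))
    ... | no  _   = nothing

    open RingSolver +-*-rawRing (fromCommutativeRing A) morphism κ-≟
      using (Polynomial; solve; con; _:=_; _:+_; _:*_; _:-_; _:^_)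

    :1 :2 :3 :4 :6 : ∀ {n} → Polynomial n
    :1 = con 1ℚ
    :2 = con (+ 2 / 1)
    :3 = con (+ 3 / 1)
    :4 = con (+ 4 / 1)
    :6 = con (+ 6 / 1)

  one two three four six : Carrier
  one = κ 1ℚ
  two = κ (+ 2 / 1)
  three = κ (+ 3 / 1)
  four = κ (+ 4 / 1)
  six = κ (+ 6 / 1)

  module CubicRoot (x τ : Carrier) where
    -- With t = x τ, the cubic divided by x reads τ (1 - x τ)² = 4/27, and the difference τ - τ (1 -
    -- x τ)² is x times this.
    higher : Carrier
    higher = (two - x * τ) * (τ * τ)

    cubic : τ ≈ κ (+ 4 / 27) + x * higher → x ≈ κ (+ 27 / 4) * (x * τ) * (one - x * τ) ^ 2
    cubic τ≈ = begin
      x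
        ≈⟨ solve 2 (λ x h → x := con (+ 27 / 4) :* (x :* (con (+ 4 / 27) :+ x :* h :- x :* h))) refl x higher ⟩
      κ (+ 27 / 4) * (x * (κ (+ 4 / 27) + x * higher - x * higher))
        ≈⟨ *-congˡ (*-congˡ (+-congʳ τ≈)) ⟨
      κ (+ 27 / 4) * (x * (τ - x * higher))
        ≈⟨ solve 2 (λ x τ → con (+ 27 / 4) :* (x :* (τ :- x :* ((:2 :- x :* τ) :* (τ :* τ))))
             := con (+ 27 / 4) :* (x :* τ) :* (:1 :- x :* τ) :^ 2) refl x τ ⟩
      κ (+ 27 / 4) * (x * τ) * (one - x * τ) ^ 2 ∎

  module CubicUnique (x t t′ : Carrier)
    (t-eq  : x ≈ κ (+ 27 / 4) * t * (one - t) ^ 2)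
    (t′-eq : x ≈ κ (+ 27 / 4) * t′ * (one - t′) ^ 2)
    where
    -- The cofactor of t - t′ in t (1-t)² - t′ (1-t′)². Its constant coefficient is 1 for series
    -- that vanish at 0, so it can be cancelled.
    unit : Carrier
    unit = one + (t * (t + t′ - two) + t′ * (t′ - two))

    unit*t≈unit*t′ : unit * t ≈ unit * t′
    unit*t≈unit*t′ = begin
      unit * t
        ≈⟨ solve 2 (λ t t′ → (:1 :+ (t :* (t :+ t′ :- :2) :+ t′ :* (t′ :- :2))) :* t
             := (:1 :+ (t :* (t :+ t′ :- :2) :+ t′ :* (t′ :- :2))) :* t′
                :+ con (+ 4 / 27) :* (con (+ 27 / 4) :* t :* (:1 :- t) :^ 2 :- con (+ 27 / 4) :* t′ :* (:1 :- t′) :^ 2))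
             refl t t′ ⟩
      unit * t′ + κ (+ 4 / 27) * (κ (+ 27 / 4) * t * (one - t) ^ 2 - κ (+ 27 / 4) * t′ * (one - t′) ^ 2)
        ≈⟨ +-congˡ (*-congˡ (+-cong t-eq (-‿cong t′-eq))) ⟨
      unit * t′ + κ (+ 4 / 27) * (x - x)
        ≈⟨ solve 2 (λ x y → y :+ con (+ 4 / 27) :* (x :- x) := y) refl x (unit * t′) ⟩
      unit * t′ ∎

  -- Here `t` stands for t(z³), while `i` and `e` stand for the inverses of 1-t and of d. They enter
  -- only through the equations they satisfy, so all checks are polynomial.
  module ClosedForm (z t i e : Carrier)
    (t-eq : z ^ 3 ≈ κ (+ 27 / 4) * t * (one - t) ^ 2)
    (i-inverse : (one - t) * i ≈ one)
    (e-inverse : (one - three * t) * (four - three * t) * e ≈ one)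
    where
    r : Carrier
    r = κ (+ 2 / 3) * i

    -- The 4 is p · 6: the equation for g₁ has weight 1 on g₀ where the interior recursion has p, so
    -- this value makes it look like the interior one.
    h : ℕ → Carrier
    h zero    = four * e
    h (suc j) = z ^ suc j * (six * e * r ^ suc j)

    hβ : Carrier
    hβ = κ q * z * h 1

    -- Each further factor r = (2/3) i consumes one factor 1-t of the cubic: two are present in z³,
    -- one in z³ r, none in z³ r².
    z³r : z ^ 3 * r ≈ κ (+ 9 / 2) * (t * (one - t))
    z³r = begin
      z ^ 3 * r
        ≈⟨ *-congʳ t-eq ⟩
      κ (+ 27 / 4) * t * (one - t) ^ 2 * r
        ≈⟨ solve 3 (λ t s i → con (+ 27 / 4) :* t :* s :^ 2 :* (con (+ 2 / 3) :* i)
             := con (+ 9 / 2) :* (t :* s) :* (s :* i)) refl t (one - t) i ⟩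
      κ (+ 9 / 2) * (t * (one - t)) * ((one - t) * i)
        ≈⟨ *-congˡ i-inverse ⟩
      κ (+ 9 / 2) * (t * (one - t)) * one
        ≈⟨ solve 1 (λ y → y :* :1 := y) refl (κ (+ 9 / 2) * (t * (one - t))) ⟩
      κ (+ 9 / 2) * (t * (one - t)) ∎

    z³r² : z ^ 3 * (r * r) ≈ three * t
    z³r² = begin
      z ^ 3 * (r * r)
        ≈⟨ *-assoc (z ^ 3) r r ⟨
      z ^ 3 * r * r
        ≈⟨ *-congʳ z³r ⟩
      κ (+ 9 / 2) * (t * (one - t)) * r
        ≈⟨ solve 3 (λ t s i → con (+ 9 / 2) :* (t :* s) :* (con (+ 2 / 3) :* i)
             := :3 :* t :* (s :* i)) refl t (one - t) i ⟩
      three * t * ((one - t) * i)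
        ≈⟨ *-congˡ i-inverse ⟩
      three * t * one
        ≈⟨ solve 1 (λ t → :3 :* t :* :1 := :3 :* t) refl t ⟩
      three * t ∎

    -- Since 3r = 2i, the right side is 3r - 2, so this is the characteristic equation r = p + q z³
    -- r³ of the interior recursion.
    z³r³ : z ^ 3 * (r * r) * r ≈ two * (i - one)
    z³r³ = begin
      z ^ 3 * (r * r) * r
        ≈⟨ *-congʳ z³r² ⟩
      three * t * (κ (+ 2 / 3) * i)
        ≈⟨ solve 2 (λ t i → :3 :* t :* (con (+ 2 / 3) :* i) := :2 :* (i :- (:1 :- t) :* i)) refl t i ⟩
      two * (i - (one - t) * i)
        ≈⟨ *-congˡ (+-congˡ (-‿cong i-inverse)) ⟩
      two * (i - one) ∎

    -- The denominator is tailored to this equation: (1-3t)(4-3t) = 4 - 2 (z³ r + z³ r²).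
    h-0 : h 0 ≈ one + z * hβ + κ q * z * h 2
    h-0 = begin
      four * e
        ≈⟨ solve 2 (λ t e → :4 :* e := (:1 :- :3 :* t) :* (:4 :- :3 :* t) :* e
             :+ :2 :* e :* (con (+ 9 / 2) :* (t :* (:1 :- t)) :+ :3 :* t)) refl t e ⟩
      (one - three * t) * (four - three * t) * e + two * e * (κ (+ 9 / 2) * (t * (one - t)) + three * t)
        ≈⟨ +-cong e-inverse (*-congˡ (+-cong (sym z³r) (sym z³r²))) ⟩
      one + two * e * (z ^ 3 * r + z ^ 3 * (r * r))
        ≈⟨ solve 3 (λ z e r → :1 :+ :2 :* e :* (z :^ 3 :* r :+ z :^ 3 :* (r :* r))
             := :1 :+ z :* (con q :* z :* (z :^ 1 :* (:6 :* e :* r :^ 1))) :+ con q :* z :* (z :^ 2 :* (:6 :* e :* r :^ 2)))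
             refl z e r ⟩
      one + z * hβ + κ q * z * h 2 ∎

    h-1 : h 1 ≈ z * h 0 + κ q * z * h 3
    h-1 = begin
      z ^ 1 * (six * e * r ^ 1)
        ≈⟨ solve 3 (λ z i e → z :^ 1 :* (:6 :* e :* (con (+ 2 / 3) :* i) :^ 1)
             := z :* (:4 :* e) :+ :2 :* z :* e :* (:2 :* (i :- :1))) refl z i e ⟩
      z * (four * e) + two * z * e * (two * (i - one))
        ≈⟨ +-congˡ (*-congˡ z³r³) ⟨
      z * (four * e) + two * z * e * (z ^ 3 * (r * r) * r)
        ≈⟨ solve 3 (λ z r e → z :* (:4 :* e) :+ :2 :* z :* e :* (z :^ 3 :* (r :* r) :* r)
             := z :* (:4 :* e) :+ con q :* z :* (z :^ 3 :* (:6 :* e :* r :^ 3))) refl z r e ⟩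
      z * h 0 + κ q * z * h 3 ∎

    h-step : ∀ j → h (2 ℕ.+ j) ≈ κ p * z * h (1 ℕ.+ j) + κ q * z * h (4 ℕ.+ j)
    h-step j = begin
      z * (z * z ^ j) * (six * e * (r * (r * r ^ j)))
        ≈⟨ solve 5 (λ z i w e v → z :* (z :* w) :* (:6 :* e :* (con (+ 2 / 3) :* i :* (con (+ 2 / 3) :* i :* v)))
             := con p :* z :* (z :* w :* (:6 :* e :* (con (+ 2 / 3) :* i :* v)))
                :+ con q :* z :* (z :* w :* (:6 :* e :* (con (+ 2 / 3) :* i :* v))) :* (:2 :* (i :- :1)))
             refl z i (z ^ j) e (r ^ j) ⟩
      κ p * z * h (1 ℕ.+ j) + κ q * z * h (1 ℕ.+ j) * (two * (i - one))
        ≈⟨ +-congˡ (*-congˡ z³r³) ⟨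
      κ p * z * h (1 ℕ.+ j) + κ q * z * h (1 ℕ.+ j) * (z ^ 3 * (r * r) * r)
        ≈⟨ +-congˡ (solve 5 (λ z r w e v → con q :* z :* (z :* w :* (:6 :* e :* (r :* v))) :* (z :^ 3 :* (r :* r) :* r)
             := con q :* z :* (z :* (z :* (z :* (z :* w))) :* (:6 :* e :* (r :* (r :* (r :* (r :* v)))))))
             refl z r (z ^ j) e (r ^ j)) ⟩
      κ p * z * h (1 ℕ.+ j) + κ q * z * h (4 ℕ.+ j) ∎

    -- The sequence is geometric with ratio r z only from index 1 on. The surplus 2 r z e at index
    -- 1, from 6 = 2 + 4, produces the V-term in the numerator of G.
    h-first : h 1 ≈ two * (r * (z * e)) + r * (z * h 0)
    h-first = solve 3 (λ z r e → z :^ 1 :* (:6 :* e :* r :^ 1) := :2 :* (r :* (z :* e)) :+ r :* (z :* (:4 :* e))) refl z r e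

    h-ratio : ∀ j → h (2 ℕ.+ j) ≈ r * (z * h (1 ℕ.+ j))
    h-ratio j = solve 5 (λ z r w e v → z :* (z :* w) :* (:6 :* e :* (r :* (r :* v))) := r :* (z :* (z :* w :* (:6 :* e :* (r :* v)))))
      refl z r (z ^ j) e (r ^ j)

  numerator : ∀ x z r e → two * ((two + r * (x * z)) * e) ≈ four * e + x * (two * (r * (z * e)))
  numerator x z r e = solve 4 (λ x z r e → :2 :* ((:2 :+ r :* (x :* z)) :* e) := :4 :* e :+ x :* (:2 :* (r :* (z :* e)))) refl x z r e

  geometric-series : ∀ f g u v → g ≈ f + u * g → (one - u) * v ≈ one → g ≈ f * v
  geometric-series f g u v g≈ v-inverse = begin
    g                   ≈⟨ solve 1 (λ g → g := g :* :1) refl g ⟩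
    g * one             ≈⟨ *-congˡ v-inverse ⟨
    g * ((one - u) * v) ≈⟨ solve 3 (λ g u v → g :* ((:1 :- u) :* v) := (g :- u :* g) :* v) refl g u v ⟩
    (g - u * g) * v     ≈⟨ *-congʳ (+-congʳ g≈) ⟩
    (f + u * g - u * g) * v ≈⟨ solve 3 (λ f y v → (f :+ y :- y) :* v := f :* v) refl f (u * g) v ⟩
    f * v               ∎

open import Relation.Binary.PropositionalEquality.Core using (refl; sym; trans)

-- The two series rings, with ℚ embedded in each.

module Sz = SeriesRing ℚ.+-*-commutativeRing recip
module Szu = SeriesRing Sz.commutativeRing Sz._⁻¹
module SzR = CommutativeRing Sz.commutativeRing
module SzuR = CommutativeRing Szu.commutativeRing

κ-morphism : +-*-rawRing -Raw-AlmostCommutative⟶ fromCommutativeRing Sz.commutativeRing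
κ-morphism = record
  { ⟦_⟧ = Sz.κ ; +-homo = Sz.κ-+ ; *-homo = Sz.κ-* ; -‿homo = Sz.κ-neg ; 0-homo = SzR.refl ; 1-homo = SzR.refl }

κκ-morphism : +-*-rawRing -Raw-AlmostCommutative⟶ fromCommutativeRing Szu.commutativeRing
κκ-morphism = record
  { ⟦_⟧    = λ a → Szu.κ (Sz.κ a)
  ; +-homo = λ a b → SzuR.trans (Szu.κ-cong (Sz.κ-+ a b)) (Szu.κ-+ (Sz.κ a) (Sz.κ b))
  ; *-homo = λ a b → SzuR.trans (Szu.κ-cong (Sz.κ-* a b)) (Szu.κ-* (Sz.κ a) (Sz.κ b))
  ; -‿homo = λ a → SzuR.trans (Szu.κ-cong (Sz.κ-neg a)) (Szu.κ-neg (Sz.κ a))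
  ; 0-homo = SzuR.refl
  ; 1-homo = SzuR.refl
  }

module SzA = RationalAlgebra Sz.commutativeRing κ-morphism
module SzuA = RationalAlgebra Szu.commutativeRing κκ-morphism

-- Existence and uniqueness of the solution.

κX*-zero : ∀ a f → (Sz.κ a Sz.* Sz.X Sz.* f) 0 ≡ 0ℚ
κX*-zero a f = trans (Sz.*-assoc (Sz.κ a) Sz.X f 0) (trans (Sz.*-κˡ a (Sz.X Sz.* f) 0)
  (trans (cong (a ·_) (Sz.X*-zero f)) (ℚ.*-zeroʳ a)))

κX*-suc : ∀ a f n → (Sz.κ a Sz.* Sz.X Sz.* f) (suc n) ≡ a · f n
κX*-suc a f n = trans (Sz.*-assoc (Sz.κ a) Sz.X f (suc n)) (trans (Sz.*-κˡ a (Sz.X Sz.* f) (suc n))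
  (cong (a ·_) (Sz.X*-suc f n)))

-- The coefficientwise form of IsSolution: one step of the random walk.
record IsWalk (g : ℕ → Sz.Series) (gβ : Sz.Series) : Set where
  field
    start-0 : g 0 0 ≡ 1ℚ
    start-β : gβ 0 ≡ 0ℚ
    start-i : ∀ i → g (suc i) 0 ≡ 0ℚ
    step-0  : ∀ n → g 0 (suc n) ≡ gβ n ⊕ q · g 2 n
    step-β  : ∀ n → gβ (suc n) ≡ q · g 1 n
    step-1  : ∀ n → g 1 (suc n) ≡ g 0 n ⊕ q · g 3 n
    step-i  : ∀ i n → g (2 ℕ.+ i) (suc n) ≡ p · g (1 ℕ.+ i) n ⊕ q · g (4 ℕ.+ i) n

open IsWalk
open IsSolution

solution⇒walk : ∀ {g gβ} → IsSolution g gβ → IsWalk g gβ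
solution⇒walk {g} {gβ} sol = record
  { start-0 = trans (eq-0 sol 0) (cong₂ _⊕_ (cong (1ℚ ⊕_) (Sz.X*-zero gβ)) (κX*-zero q (g 2)))
  ; start-β = trans (eq-β sol 0) (κX*-zero q (g 1))
  ; start-i = λ where
      zero    → trans (eq-1 sol 0) (cong₂ _⊕_ (Sz.X*-zero (g 0)) (κX*-zero q (g 3)))
      (suc i) → trans (eq-i sol i 0) (cong₂ _⊕_ (κX*-zero p (g (1 ℕ.+ i))) (κX*-zero q (g (4 ℕ.+ i))))
  ; step-0  = λ n → trans (eq-0 sol (suc n))
      (cong₂ _⊕_ (trans (cong (0ℚ ⊕_) (Sz.X*-suc gβ n)) (ℚ.+-identityˡ (gβ n))) (κX*-suc q (g 2) n))
  ; step-β  = λ n → trans (eq-β sol (suc n)) (κX*-suc q (g 1) n)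
  ; step-1  = λ n → trans (eq-1 sol (suc n)) (cong₂ _⊕_ (Sz.X*-suc (g 0) n) (κX*-suc q (g 3) n))
  ; step-i  = λ i n → trans (eq-i sol i (suc n)) (cong₂ _⊕_ (κX*-suc p (g (1 ℕ.+ i)) n) (κX*-suc q (g (4 ℕ.+ i)) n))
  }

walk⇒solution : ∀ {g gβ} → IsWalk g gβ → IsSolution g gβ
walk⇒solution {g} {gβ} w = record
  { eq-0 = λ where
      zero    → trans (start-0 w) (sym (cong₂ _⊕_ (cong (1ℚ ⊕_) (Sz.X*-zero gβ)) (κX*-zero q (g 2))))
      (suc n) → trans (step-0 w n)
        (sym (cong₂ _⊕_ (trans (cong (0ℚ ⊕_) (Sz.X*-suc gβ n)) (ℚ.+-identityˡ (gβ n))) (κX*-suc q (g 2) n)))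
  ; eq-β = λ where
      zero    → trans (start-β w) (sym (κX*-zero q (g 1)))
      (suc n) → trans (step-β w n) (sym (κX*-suc q (g 1) n))
  ; eq-1 = λ where
      zero    → trans (start-i w 0) (sym (cong₂ _⊕_ (Sz.X*-zero (g 0)) (κX*-zero q (g 3))))
      (suc n) → trans (step-1 w n) (sym (cong₂ _⊕_ (Sz.X*-suc (g 0) n) (κX*-suc q (g 3) n)))
  ; eq-i = λ where
      i zero    → trans (start-i w (suc i)) (sym (cong₂ _⊕_ (κX*-zero p (g (1 ℕ.+ i))) (κX*-zero q (g (4 ℕ.+ i)))))
      i (suc n) → trans (step-i w i n) (sym (cong₂ _⊕_ (κX*-suc p (g (1 ℕ.+ i)) n) (κX*-suc q (g (4 ℕ.+ i)) n)))
  }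

mutual
  walk : ℕ → Sz.Series
  walk 0             zero    = 1ℚ
  walk (suc i)       zero    = 0ℚ
  walk 0             (suc n) = walkβ n ⊕ q · walk 2 n
  walk 1             (suc n) = walk 0 n ⊕ q · walk 3 n
  walk (suc (suc i)) (suc n) = p · walk (1 ℕ.+ i) n ⊕ q · walk (4 ℕ.+ i) n

  walkβ : Sz.Series
  walkβ zero    = 0ℚ
  walkβ (suc n) = q · walk 1 n

walk-isWalk : IsWalk walk walkβ
walk-isWalk = record
  { start-0 = refl ; start-β = refl ; start-i = λ _ → refl
  ; step-0 = λ _ → refl ; step-β = λ _ → refl ; step-1 = λ _ → refl ; step-i = λ _ _ → refl
  }

module _ {g g′ gβ gβ′} (w : IsWalk g gβ) (w′ : IsWalk g′ gβ′) where
  -- The induction hypothesis covers all states at once, because the recursion at a state reads a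
  -- higher state at the previous time.
  walk-unique : ∀ n → (∀ i → g i n ≡ g′ i n) × gβ n ≡ gβ′ n
  walk-unique zero = (λ where zero    → trans (start-0 w) (sym (start-0 w′))
                              (suc i) → trans (start-i w i) (sym (start-i w′ i)))
                   , trans (start-β w) (sym (start-β w′))
  walk-unique (suc n) with walk-unique n
  ... | g≡ , gβ≡ =
      (λ where zero          → trans (step-0 w n) (trans (cong₂ (λ a b → a ⊕ q · b) gβ≡ (g≡ 2)) (sym (step-0 w′ n)))
               (suc zero)    → trans (step-1 w n) (trans (cong₂ (λ a b → a ⊕ q · b) (g≡ 0) (g≡ 3)) (sym (step-1 w′ n)))
               (suc (suc i)) → trans (step-i w i n) (trans (cong₂ (λ a b → p · a ⊕ q · b) (g≡ (1 ℕ.+ i)) (g≡ (4 ℕ.+ i))) (sym (step-i w′ i n))))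
    , trans (step-β w n) (trans (cong (q ·_) (g≡ 1)) (sym (step-β w′ n)))

solution-unique : ∀ {g g′ gβ gβ′} → IsSolution g gβ → IsSolution g′ gβ′ → g Szu.≈ g′ × gβ Sz.≈ gβ′
solution-unique sol sol′ =
    (λ i n → proj₁ (walk-unique (solution⇒walk sol) (solution⇒walk sol′) n) i)
  , (λ n → proj₂ (walk-unique (solution⇒walk sol) (solution⇒walk sol′) n))

∃!-solution : ∃! (Pointwise ℚ⟦z⟧⟦u⟧._≈_ ℚ⟦z⟧._≈_) (uncurry IsSolution)
∃!-solution = (walk , walkβ) , sol , solution-unique sol
  where sol = walk⇒solution walk-isWalk

-- One step raises the state by at most one.
walk-vanishes : ∀ {g gβ} → IsWalk g gβ → ∀ {i n} → n < i → g i n ≡ 0ℚ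
walk-vanishes w {suc i} {zero} _ = start-i w i
walk-vanishes w {suc (suc i)} {suc n} (s≤s n≤i) = trans (step-i w i n)
  (cong₂ (λ a b → p · a ⊕ q · b) (walk-vanishes w n≤i) (walk-vanishes w (ℕ.≤-trans n≤i (ℕ.m≤n+m _ 3))))

-- Existence and uniqueness of t.

-- The cubic equation for t is solved by t = x τ, where τ = 4/27 + x (2 - x τ) τ².
module CubicSolution where
  higher : Sz.Series → Sz.Series
  higher = SzA.CubicRoot.higher Sz.X

  -- `higher` only preserves the degree of agreement; the factor `Sz.X` in front of it in `Φ`
  -- supplies the contraction.
  higher-local : ∀ f g n → f Sz.≈[ n ] g → higher f Sz.≈[ n ] higher g
  higher-local f g n f≈g k k≤n = Sz.*-local k (SzA.two Sz.- Sz.X Sz.* f) (SzA.two Sz.- Sz.X Sz.* g) (f Sz.* f) (g Sz.* g)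
    (λ l l≤k → cong (λ c → SzA.two l ⊕ ℚ.- c) (Sz.*-local l Sz.X Sz.X f g (λ _ _ → refl) (agree (ℕ.≤-trans l≤k k≤n))))
    (λ l l≤k → Sz.*-local l f g f g (agree (ℕ.≤-trans l≤k k≤n)) (agree (ℕ.≤-trans l≤k k≤n)))
    where
    agree : ∀ {l} → l ≤ n → f Sz.≈[ l ] g
    agree l≤n m m≤l = f≈g m (ℕ.≤-trans m≤l l≤n)

  Φ : Sz.Series → Sz.Series
  Φ τ = Sz.κ (+ 4 / 27) Sz.+ Sz.X Sz.* higher τ

  Φ-contracts : Sz.Contraction Φ
  Φ-contracts = Sz.+-contracts (Sz.κ (+ 4 / 27)) (λ τ → Sz.X Sz.* higher τ) λ f g n f≈g →
    Sz.*-contracts Sz.X refl (higher f) (higher g) n λ k k<n →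
      higher-local f g k (λ l l≤k → f≈g l (ℕ.≤-<-trans l≤k k<n)) k ℕ.≤-refl

  open Sz.FixedPoint Φ Φ-contracts public

isT-unique : ∀ {t t′} → IsT t → IsT t′ → t Sz.≈ t′
isT-unique {t} {t′} isT isT′ = Sz.*-cancelˡ-invertible unit (cong (λ c → c · recip c) unit₀≡1) unit*t≈unit*t′
  where
  open IsT
  open SzA.CubicUnique Sz.X t t′ (equation isT) (equation isT′)
  unit₀≡1 : unit 0 ≡ 1ℚ
  unit₀≡1 = cong₂ (λ a b → 1ℚ ⊕ ((a ⊕ 0ℚ) ⊕ (b ⊕ 0ℚ)))
    (trans (cong (_· ((t Sz.+ t′ Sz.- SzA.two) 0)) (constant isT)) (ℚ.*-zeroˡ ((t Sz.+ t′ Sz.- SzA.two) 0)))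
    (trans (cong (_· ((t′ Sz.- SzA.two) 0)) (constant isT′)) (ℚ.*-zeroˡ ((t′ Sz.- SzA.two) 0)))

∃!-t : ∃! ℚ⟦z⟧._≈_ IsT
∃!-t = Sz.X Sz.* fix , isT , isT-unique isT
  where
  open CubicSolution
  isT : IsT (Sz.X Sz.* fix)
  isT = record { constant = Sz.X*-zero fix ; equation = SzA.CubicRoot.cubic Sz.X fix fix-fixed }

-- Substitution of z³ as a ring homomorphism.

∘z³-support : ∀ f n → (f ∘z³) n ≢ 0ℚ → 3 ∣ n
∘z³-support f n fn≢0 with 3 ∣? n
... | yes 3∣n = 3∣n
... | no  _   = contradiction refl fn≢0

-- This allows induction in steps of three: dropping three coefficients of f(z³) drops one of f.
∘z³-tail : ∀ f n → (f ∘z³) (3 ℕ.+ n) ≡ (Sz.tail f ∘z³) n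
∘z³-tail f n with 3 ∣? (3 ℕ.+ n) | 3 ∣? n
... | yes (divides k 3+n≡k*3) | yes (divides l n≡l*3) =
        cong f (ℕ.*-cancelʳ-≡ k (suc l) 3 (trans (sym 3+n≡k*3) (cong (3 ℕ.+_) n≡l*3)))
... | yes 3∣3+n | no 3∤n = contradiction (∣m+n∣m⇒∣n 3∣3+n ∣-refl) 3∤n
... | no 3∤3+n | yes 3∣n = contradiction (∣m∣n⇒∣m+n ∣-refl 3∣n) 3∤3+n
... | no _ | no _ = refl

∘z³-cong : ∀ {f g} → f Sz.≈ g → f ∘z³ Sz.≈ g ∘z³
∘z³-cong f≈g n with 3 ∣? n
... | yes 3∣n = f≈g (quotient 3∣n)
... | no  _   = refl

∘z³-+ : ∀ f g → (f Sz.+ g) ∘z³ Sz.≈ f ∘z³ Sz.+ g ∘z³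
∘z³-+ f g n with 3 ∣? n
... | yes _ = refl
... | no  _ = refl

∘z³-neg : ∀ f → (Sz.- f) ∘z³ Sz.≈ Sz.- (f ∘z³)
∘z³-neg f n with 3 ∣? n
... | yes _ = refl
... | no  _ = refl

∘z³-scale : ∀ a f n → ((λ k → a · f k) ∘z³) n ≡ a · (f ∘z³) n
∘z³-scale a f n with 3 ∣? n
... | yes _ = refl
... | no  _ = sym (ℚ.*-zeroʳ a)

∘z³-κ : ∀ a → Sz.κ a ∘z³ Sz.≈ Sz.κ a
∘z³-κ a 0 = refl
∘z³-κ a 1 = refl
∘z³-κ a 2 = refl
∘z³-κ a (suc (suc (suc n))) = trans (∘z³-tail (Sz.κ a) n) (zero-∘z³ n)
  where
  zero-∘z³ : ∀ n → ((λ _ → 0ℚ) ∘z³) n ≡ 0ℚ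
  zero-∘z³ n with 3 ∣? n
  ... | yes _ = refl
  ... | no  _ = refl

∘z³-* : ∀ f g → (f Sz.* g) ∘z³ Sz.≈ f ∘z³ Sz.* g ∘z³
∘z³-* f g 0 = refl
∘z³-* f g 1 = sym (cong₂ (λ a b → a ⊕ (b ⊕ 0ℚ)) (ℚ.*-zeroʳ (f 0)) (ℚ.*-zeroˡ (g 0)))
∘z³-* f g 2 = sym (cong₂ (λ a b → a ⊕ (0ℚ · 0ℚ ⊕ (b ⊕ 0ℚ))) (ℚ.*-zeroʳ (f 0)) (ℚ.*-zeroˡ (g 0)))
∘z³-* f g (suc (suc (suc n))) = begin
  ((f Sz.* g) ∘z³) (3 ℕ.+ n)
    ≡⟨ ∘z³-tail (f Sz.* g) n ⟩
  (((λ k → f 0 · Sz.tail g k) Sz.+ Sz.tail f Sz.* g) ∘z³) n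
    ≡⟨ ∘z³-+ (λ k → f 0 · Sz.tail g k) (Sz.tail f Sz.* g) n ⟩
  ((λ k → f 0 · Sz.tail g k) ∘z³) n ⊕ ((Sz.tail f Sz.* g) ∘z³) n
    ≡⟨ cong₂ _⊕_ (∘z³-scale (f 0) (Sz.tail g) n) (∘z³-* (Sz.tail f) g n) ⟩
  f 0 · (Sz.tail g ∘z³) n ⊕ (Sz.tail f ∘z³ Sz.* g ∘z³) n
    ≡⟨ cong₂ _⊕_ (cong (f 0 ·_) (∘z³-tail g n)) (Sz.*-cong {g = g ∘z³} (∘z³-tail f) SzR.refl n) ⟨
  f 0 · (g ∘z³) (3 ℕ.+ n) ⊕ ((λ k → (f ∘z³) (3 ℕ.+ k)) Sz.* g ∘z³) n
    -- The terms k = 1 and k = 2 of the convolution vanish, since `f ∘z³` has coefficient 0 there.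
    ≡⟨ cong (f 0 · (g ∘z³) (3 ℕ.+ n) ⊕_) (trans (cong₂ (λ a b → a ⊕ (b ⊕ rest))
         (ℚ.*-zeroˡ ((g ∘z³) (2 ℕ.+ n))) (ℚ.*-zeroˡ ((g ∘z³) (1 ℕ.+ n)))) (trans (ℚ.+-identityˡ _) (ℚ.+-identityˡ _))) ⟨
  (f ∘z³ Sz.* g ∘z³) (3 ℕ.+ n) ∎
  where
  open ≡-Reasoning
  rest : ℚ
  rest = ((λ k → (f ∘z³) (3 ℕ.+ k)) Sz.* g ∘z³) n

∘z³-X : Sz.X ∘z³ Sz.≈ Sz.X Sz.^ 3
∘z³-X 0 = refl
∘z³-X 1 = refl
∘z³-X 2 = refl
∘z³-X (suc (suc (suc n))) = begin
  (Sz.X ∘z³) (3 ℕ.+ n)       ≡⟨ ∘z³-tail Sz.X n ⟩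
  (Sz.tail Sz.X ∘z³) n        ≡⟨ ∘z³-cong {Sz.tail Sz.X} {Sz.1#} (λ { zero → refl ; (suc _) → refl }) n ⟩
  (Sz.1# ∘z³) n              ≡⟨ ∘z³-κ 1ℚ n ⟩
  Sz.1# n                    ≡⟨ Sz.X*-suc Sz.1# n ⟨
  (Sz.X Sz.^ 1) (1 ℕ.+ n)     ≡⟨ Sz.X*-suc (Sz.X Sz.^ 1) (1 ℕ.+ n) ⟨
  (Sz.X Sz.^ 2) (2 ℕ.+ n)     ≡⟨ Sz.X*-suc (Sz.X Sz.^ 2) (2 ℕ.+ n) ⟨
  (Sz.X Sz.^ 3) (3 ℕ.+ n)     ∎
  where open ≡-Reasoning

∘z³-^ : ∀ f k → (f Sz.^ k) ∘z³ Sz.≈ f ∘z³ Sz.^ k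
∘z³-^ f zero    = ∘z³-κ 1ℚ
∘z³-^ f (suc k) = SzR.trans (∘z³-* f (f Sz.^ k)) (SzR.*-congˡ {f ∘z³} (∘z³-^ f k))

-- Both sides are inverses of `g`, so the sum defining `_⁻¹` need not be unfolded.
∘z³-⁻¹ : ∀ {f g} → f 0 · recip (f 0) ≡ 1ℚ → g 0 · recip (g 0) ≡ 1ℚ → f ∘z³ Sz.≈ g → (f Sz.⁻¹) ∘z³ Sz.≈ g Sz.⁻¹
∘z³-⁻¹ {f} {g} f₀-unit g₀-unit f∘z³≈g = Sz.*-cancelˡ-invertible g g₀-unit (begin
  g Sz.* (f Sz.⁻¹) ∘z³      ≈⟨ SzR.*-congʳ {(f Sz.⁻¹) ∘z³} f∘z³≈g ⟨
  f ∘z³ Sz.* (f Sz.⁻¹) ∘z³  ≈⟨ ∘z³-* f (f Sz.⁻¹) ⟨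
  (f Sz.* f Sz.⁻¹) ∘z³      ≈⟨ ∘z³-cong (Sz.⁻¹-inverseʳ f f₀-unit) ⟩
  Sz.1# ∘z³                ≈⟨ ∘z³-κ 1ℚ ⟩
  Sz.1#                    ≈⟨ Sz.⁻¹-inverseʳ g g₀-unit ⟨
  g Sz.* g Sz.⁻¹            ∎)
  where open SetoidReasoning SzR.setoid

-- The coefficients of G in V, as functions of t.

1-t : Sz.Series → Sz.Series
1-t t = Sz.1# Sz.- t

denominator : Sz.Series → Sz.Series
denominator t = (Sz.1# Sz.- SzA.three Sz.* t) Sz.* (SzA.four Sz.- SzA.three Sz.* t)

ratio : Sz.Series → Sz.Series
ratio t = Sz.κ (+ 2 / 3) Sz.* (1-t t) Sz.⁻¹

private
  module SE = SemiringExp SzR.semiring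
  module BCS = CommutativeSemigroupProperties SzuR.*-commutativeSemigroup

-- [Vʲ]G as a function of t.
coeffV : Sz.Series → ℕ → Sz.Series
coeffV t zero    = SzA.four Sz.* (denominator t) Sz.⁻¹
coeffV t (suc j) = SzA.six Sz.* (denominator t) Sz.⁻¹ Sz.* ratio t Sz.^ suc j

module _ (t : Sz.Series) (t₀≡0 : t 0 ≡ 0ℚ) where
  -- Once `t 0` is replaced by 0, a closed rational identity remains and holds by evaluation; the
  -- same goes for `denominator-unit`.
  1-t-unit : 1-t t 0 · recip (1-t t 0) ≡ 1ℚ
  1-t-unit = cong (λ a → (1ℚ ℚ.- a) · recip (1ℚ ℚ.- a)) t₀≡0

  denominator-unit : denominator t 0 · recip (denominator t 0) ≡ 1ℚ
  denominator-unit = cong (λ a → d a · recip (d a)) t₀≡0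
    where
    d : ℚ → ℚ
    d a = (1ℚ ℚ.- ((+ 3 / 1) · a ⊕ 0ℚ)) · ((+ 4 / 1) ℚ.- ((+ 3 / 1) · a ⊕ 0ℚ)) ⊕ 0ℚ

∘z³-1-t : ∀ t → (1-t t) ∘z³ Sz.≈ 1-t (t ∘z³)
∘z³-1-t t = SzR.trans (∘z³-+ Sz.1# (Sz.- t)) (SzR.+-cong {_} {Sz.1#} (∘z³-κ 1ℚ) (∘z³-neg t))

∘z³-linear : ∀ a b t → (Sz.κ a Sz.- Sz.κ b Sz.* t) ∘z³ Sz.≈ Sz.κ a Sz.- Sz.κ b Sz.* t ∘z³
∘z³-linear a b t = begin
  (Sz.κ a Sz.- Sz.κ b Sz.* t) ∘z³           ≈⟨ ∘z³-+ (Sz.κ a) (Sz.- (Sz.κ b Sz.* t)) ⟩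
  Sz.κ a ∘z³ Sz.+ (Sz.- (Sz.κ b Sz.* t)) ∘z³ ≈⟨ SzR.+-cong {_} {Sz.κ a} (∘z³-κ a) (∘z³-neg (Sz.κ b Sz.* t)) ⟩
  Sz.κ a Sz.- (Sz.κ b Sz.* t) ∘z³           ≈⟨ SzR.+-congˡ {Sz.κ a} (SzR.-‿cong (∘z³-* (Sz.κ b) t)) ⟩
  Sz.κ a Sz.- Sz.κ b ∘z³ Sz.* t ∘z³         ≈⟨ SzR.+-congˡ {Sz.κ a} (SzR.-‿cong (SzR.*-congʳ {t ∘z³} (∘z³-κ b))) ⟩
  Sz.κ a Sz.- Sz.κ b Sz.* t ∘z³             ∎
  where open SetoidReasoning SzR.setoid

∘z³-denominator : ∀ t → denominator t ∘z³ Sz.≈ denominator (t ∘z³)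
∘z³-denominator t = SzR.trans (∘z³-* (Sz.1# Sz.- SzA.three Sz.* t) (SzA.four Sz.- SzA.three Sz.* t))
  (Sz.*-cong (∘z³-linear 1ℚ (+ 3 / 1) t) (∘z³-linear (+ 4 / 1) (+ 3 / 1) t))

module _ (t : Sz.Series) (t₀≡0 : t 0 ≡ 0ℚ) where
  private
    d⁻¹ = (denominator t) Sz.⁻¹
    T   = t ∘z³

  ∘z³-scaled-d⁻¹ : ∀ a → (Sz.κ a Sz.* d⁻¹) ∘z³ Sz.≈ Sz.κ a Sz.* (denominator T) Sz.⁻¹
  ∘z³-scaled-d⁻¹ a = SzR.trans (∘z³-* (Sz.κ a) d⁻¹) (Sz.*-cong (∘z³-κ a)
    (∘z³-⁻¹ (denominator-unit t t₀≡0) (denominator-unit T t₀≡0) (∘z³-denominator t)))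

  ∘z³-ratio : ratio t ∘z³ Sz.≈ ratio T
  ∘z³-ratio = SzR.trans (∘z³-* (Sz.κ (+ 2 / 3)) ((1-t t) Sz.⁻¹)) (Sz.*-cong (∘z³-κ (+ 2 / 3))
    (∘z³-⁻¹ (1-t-unit t t₀≡0) (1-t-unit T t₀≡0) (∘z³-1-t t)))

  ∘z³-coeffV : ∀ j → coeffV t j ∘z³ Sz.≈ coeffV T j
  ∘z³-coeffV zero    = ∘z³-scaled-d⁻¹ (+ 4 / 1)
  ∘z³-coeffV (suc j) = SzR.trans (∘z³-* (SzA.six Sz.* d⁻¹) (ratio t Sz.^ suc j))
    (Sz.*-cong (∘z³-scaled-d⁻¹ (+ 6 / 1)) (SzR.trans (∘z³-^ (ratio t) (suc j)) (SE.^-congˡ (suc j) ∘z³-ratio)))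

  cubic-∘z³ : Sz.X Sz.≈ Sz.κ (+ 27 / 4) Sz.* t Sz.* (1-t t) Sz.^ 2 →
              Sz.X Sz.^ 3 Sz.≈ Sz.κ (+ 27 / 4) Sz.* T Sz.* (1-t T) Sz.^ 2
  cubic-∘z³ t-eq = begin
    Sz.X Sz.^ 3
      ≈⟨ ∘z³-X ⟨
    Sz.X ∘z³
      ≈⟨ ∘z³-cong t-eq ⟩
    (Sz.κ (+ 27 / 4) Sz.* t Sz.* (1-t t) Sz.^ 2) ∘z³
      ≈⟨ ∘z³-* (Sz.κ (+ 27 / 4) Sz.* t) ((1-t t) Sz.^ 2) ⟩
    (Sz.κ (+ 27 / 4) Sz.* t) ∘z³ Sz.* ((1-t t) Sz.^ 2) ∘z³
      ≈⟨ Sz.*-cong (SzR.trans (∘z³-* (Sz.κ (+ 27 / 4)) t) (SzR.*-congʳ {T} (∘z³-κ (+ 27 / 4))))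
                  (SzR.trans (∘z³-^ (1-t t) 2) (SE.^-congˡ 2 (∘z³-1-t t))) ⟩
    Sz.κ (+ 27 / 4) Sz.* T Sz.* (1-t T) Sz.^ 2 ∎
    where open SetoidReasoning SzR.setoid

-- The closed form of G.

module S = ℚ⟦z⟧
module B = ℚ⟦z⟧⟦u⟧

-- The operations of Szu and B are definitionally equal, but comparing compound
-- expressions would unfold all the nested sums, hence one operation at a time.
module _ {f f′ : Szu.Series} where
  ⁻¹-≡ : f ≡ f′ → f Szu.⁻¹ ≡ f′ B.⁻¹
  ⁻¹-≡ refl = refl

  module _ {g g′ : Szu.Series} where
    +-≡ : f ≡ f′ → g ≡ g′ → f Szu.+ g ≡ f′ B.+ g′
    +-≡ refl refl = refl

    *-≡ : f ≡ f′ → g ≡ g′ → f Szu.* g ≡ f′ B.* g′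
    *-≡ refl refl = refl

    -‿≡ : f ≡ f′ → g ≡ g′ → f Szu.- g ≡ f′ B.- g′
    -‿≡ refl refl = refl

module GeneratingFunction {g gβ t} (sol : IsSolution g gβ) (isT : IsT t) where
  private
    open IsT isT
    T = t ∘z³
    z = Sz.X
    r = ratio T
    d = denominator T
    e = d Sz.⁻¹

  open SzA.ClosedForm z T ((1-t T) Sz.⁻¹) e (cubic-∘z³ t constant equation)
    (Sz.⁻¹-inverseʳ (1-t T) (1-t-unit T constant))
    (Sz.⁻¹-inverseʳ d (denominator-unit T constant))
    using (h; hβ; h-0; h-1; h-step; h-first; h-ratio)

  G≈h : g Szu.≈ h
  G≈h = proj₁ (solution-unique sol (record { eq-0 = h-0 ; eq-β = λ _ → refl ; eq-1 = h-1 ; eq-i = h-step }))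

  h≈z^j*coeffV : ∀ j → h j Sz.≈ z Sz.^ j Sz.* coeffV T j
  h≈z^j*coeffV zero    = SzR.sym (Sz.*-identityˡ (SzA.four Sz.* e))
  h≈z^j*coeffV (suc j) = SzR.refl

  G≈z^j*coeffV : ∀ j → g j Sz.≈ z Sz.^ j Sz.* coeffV T j
  G≈z^j*coeffV j = SzR.trans (G≈h j) (h≈z^j*coeffV j)

  -- Multiplication by zʲ is injective, so G(u,z) = H(uz,z) determines H.
  coeffV-unique : ∀ H → g Szu.≈ H [V≔uz] → ∀ j → H j Sz.≈ coeffV T j
  coeffV-unique H G≈H j = Sz.X^*-cancel j (SzR.trans (SzR.sym (G≈H j)) (G≈z^j*coeffV j))

  -- The witness substitutes z³ after forming the coefficient, rather than forming it from `T`. Its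
  -- support is then evident, and the homomorphism property of `_∘z³` identifies the two.
  in-powers-of-z³ : ∃ λ H → (g Szu.≈ H [V≔uz]) × (∀ j n → H j n ≢ 0ℚ → 3 ∣ n)
  in-powers-of-z³ = (λ j → coeffV t j ∘z³)
    , (λ j → SzR.trans (G≈z^j*coeffV j) (SzR.*-congˡ {z Sz.^ j} (SzR.sym (∘z³-coeffV t constant j))))
    , (λ j → ∘z³-support (coeffV t j))

  private
    V = Szu.X Szu.* Szu.κ z

    -- The claim inverts d as a constant series in u, whereas the candidate uses the inverse in
    -- ℚ⟦z⟧. Uniqueness of inverses reconciles them.
    κd⁻¹ : (Szu.κ d) Szu.⁻¹ Szu.≈ Szu.κ e
    κd⁻¹ = Szu.*-cancelˡ-invertible (Szu.κ d) d-unit (begin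
      Szu.κ d Szu.* (Szu.κ d) Szu.⁻¹  ≈⟨ Szu.⁻¹-inverseʳ (Szu.κ d) d-unit ⟩
      Szu.1#                    ≈⟨ Szu.κ-cong d-unit ⟨
      Szu.κ (d Sz.* e)           ≈⟨ Szu.κ-* d e ⟩
      Szu.κ d Szu.* Szu.κ e         ∎)
      where
      open SetoidReasoning SzuR.setoid
      d-unit : d Sz.* e Sz.≈ Sz.1#
      d-unit = Sz.⁻¹-inverseʳ d (denominator-unit T constant)

    numerator≈ : Szu.κ SzA.two Szu.* ((Szu.κ SzA.two Szu.+ Szu.κ r Szu.* V) Szu.* (Szu.κ d) Szu.⁻¹) Szu.≈ Szu.κ (SzA.four Sz.* e) Szu.+ Szu.X Szu.* Szu.κ (SzA.two Sz.* (r Sz.* (z Sz.* e)))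
    numerator≈ = begin
      Szu.κ SzA.two Szu.* ((Szu.κ SzA.two Szu.+ Szu.κ r Szu.* V) Szu.* (Szu.κ d) Szu.⁻¹)
        ≈⟨ SzuR.*-congˡ {Szu.κ SzA.two} (SzuR.*-congˡ {Szu.κ SzA.two Szu.+ Szu.κ r Szu.* V} κd⁻¹) ⟩
      Szu.κ SzA.two Szu.* ((Szu.κ SzA.two Szu.+ Szu.κ r Szu.* V) Szu.* Szu.κ e)
        ≈⟨ SzuA.numerator Szu.X (Szu.κ z) (Szu.κ r) (Szu.κ e) ⟩
      Szu.κ SzA.four Szu.* Szu.κ e Szu.+ Szu.X Szu.* (Szu.κ SzA.two Szu.* (Szu.κ r Szu.* (Szu.κ z Szu.* Szu.κ e)))
        ≈⟨ SzuR.+-cong (Szu.κ-* SzA.four e) (SzuR.*-congˡ {Szu.X} (SzuR.trans (Szu.κ-* SzA.two (r Sz.* (z Sz.* e)))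
             (SzuR.*-congˡ {Szu.κ SzA.two} (SzuR.trans (Szu.κ-* r (z Sz.* e)) (SzuR.*-congˡ {Szu.κ r} (Szu.κ-* z e)))))) ⟨
      Szu.κ (SzA.four Sz.* e) Szu.+ Szu.X Szu.* Szu.κ (SzA.two Sz.* (r Sz.* (z Sz.* e))) ∎
      where open SetoidReasoning SzuR.setoid

    rV*h : Szu.κ r Szu.* V Szu.* h Szu.≈ Szu.X Szu.* (λ j → r Sz.* (z Sz.* h j))
    rV*h = begin
      Szu.κ r Szu.* (Szu.X Szu.* Szu.κ z) Szu.* h    ≈⟨ SzuR.*-congʳ {h} (BCS.x∙yz≈y∙xz (Szu.κ r) Szu.X (Szu.κ z)) ⟩
      Szu.X Szu.* (Szu.κ r Szu.* Szu.κ z) Szu.* h    ≈⟨ Szu.*-assoc Szu.X (Szu.κ r Szu.* Szu.κ z) h ⟩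
      Szu.X Szu.* (Szu.κ r Szu.* Szu.κ z Szu.* h)    ≈⟨ SzuR.*-congˡ {Szu.X} (Szu.*-assoc (Szu.κ r) (Szu.κ z) h) ⟩
      Szu.X Szu.* (Szu.κ r Szu.* (Szu.κ z Szu.* h))  ≈⟨ SzuR.*-congˡ {Szu.X} (λ j → SzR.trans (Szu.*-κˡ r (Szu.κ z Szu.* h) j) (SzR.*-congˡ {r} (Szu.*-κˡ z h j))) ⟩
      Szu.X Szu.* (λ j → r Sz.* (z Sz.* h j))  ∎
      where open SetoidReasoning SzuR.setoid

    h-recurrence : h Szu.≈ Szu.κ (SzA.four Sz.* e) Szu.+ Szu.X Szu.* Szu.κ (SzA.two Sz.* (r Sz.* (z Sz.* e))) Szu.+ Szu.X Szu.* (λ j → r Sz.* (z Sz.* h j))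
    h-recurrence zero = SzR.sym (begin
      SzA.four Sz.* e Sz.+ (Szu.X Szu.* N) 0 Sz.+ (Szu.X Szu.* K) 0
        ≈⟨ SzR.+-cong {x = SzA.four Sz.* e Sz.+ (Szu.X Szu.* N) 0} (SzR.+-congˡ {SzA.four Sz.* e} (Szu.X*-zero N)) (Szu.X*-zero K) ⟩
      SzA.four Sz.* e Sz.+ Sz.0# Sz.+ Sz.0#
        ≈⟨ SzR.trans (SzR.+-identityʳ (SzA.four Sz.* e Sz.+ Sz.0#)) (SzR.+-identityʳ (SzA.four Sz.* e)) ⟩
      h 0 ∎)
      where
      open SetoidReasoning SzR.setoid
      N K : Szu.Series
      N = Szu.κ (SzA.two Sz.* (r Sz.* (z Sz.* e)))
      K = λ j → r Sz.* (z Sz.* h j)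
    h-recurrence (suc n) = SzR.sym (begin
      Sz.0# Sz.+ (Szu.X Szu.* N) (suc n) Sz.+ (Szu.X Szu.* K) (suc n)
        ≈⟨ SzR.+-cong {x = Sz.0# Sz.+ (Szu.X Szu.* N) (suc n)} (SzR.trans (SzR.+-identityˡ ((Szu.X Szu.* N) (suc n))) (Szu.X*-suc N n)) (Szu.X*-suc K n) ⟩
      N n Sz.+ r Sz.* (z Sz.* h n)
        ≈⟨ coefficient n ⟩
      h (suc n) ∎)
      where
      open SetoidReasoning SzR.setoid
      N K : Szu.Series
      N = Szu.κ (SzA.two Sz.* (r Sz.* (z Sz.* e)))
      K = λ j → r Sz.* (z Sz.* h j)
      coefficient : ∀ n → N n Sz.+ r Sz.* (z Sz.* h n) Sz.≈ h (suc n)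
      coefficient zero    = SzR.sym h-first
      coefficient (suc n) = SzR.trans (SzR.+-identityˡ (r Sz.* (z Sz.* h (suc n)))) (SzR.sym (h-ratio n))

    P : Szu.Series
    P = Szu.1# Szu.- Szu.κ r Szu.* V

    -- Invertibility is lifted twice: V has no constant term, so `P 0 0` is 1, hence `P 0` is a unit
    -- in ℚ⟦z⟧, hence `P` is one in ℚ⟦z⟧⟦u⟧.
    P-inverse : P Szu.* P Szu.⁻¹ Szu.≈ Szu.1#
    P-inverse = Szu.⁻¹-inverseʳ P (Sz.⁻¹-inverseʳ (P 0) P₀₀-unit)
      where
      P₀₀-unit : P 0 0 · recip (P 0 0) ≡ 1ℚ
      P₀₀-unit = cong (λ a → a · recip a) {P 0 0} {1ℚ} (cong (λ a → 1ℚ ℚ.- (a ⊕ 0ℚ ⊕ 0ℚ)) (ℚ.*-zeroʳ (r 0)))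

  rational-form : g Szu.≈ Szu.κ SzA.two Szu.* ((Szu.κ SzA.two Szu.+ Szu.κ r Szu.* V) Szu.* (Szu.κ d) Szu.⁻¹) Szu.* (Szu.1# Szu.- Szu.κ r Szu.* V) Szu.⁻¹
  rational-form = SzuR.trans G≈h (SzuA.geometric-series F h (Szu.κ r Szu.* V) (P Szu.⁻¹)
    (SzuR.trans h-recurrence (SzuR.+-cong {y = F} (SzuR.sym numerator≈) (SzuR.sym rV*h))) P-inverse)
    where F = Szu.κ SzA.two Szu.* ((Szu.κ SzA.two Szu.+ Szu.κ r Szu.* V) Szu.* (Szu.κ d) Szu.⁻¹)

  rational-form-ℚ⟦z⟧⟦u⟧ :
    let two = S.κ (+ 2 / 1)
        V = B.X B.* B.κ S.X
        r = S.κ (+ 2 / 3) S.* (S.1# S.- t ∘z³) S.⁻¹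
        d = (S.1# S.- S.κ (+ 3 / 1) S.* t ∘z³) S.* (S.κ (+ 4 / 1) S.- S.κ (+ 3 / 1) S.* t ∘z³)
    in g B.≈ B.κ two B.* ((B.κ two B.+ B.κ r B.* V) B.* (B.κ d) B.⁻¹) B.* (B.1# B.- B.κ r B.* V) B.⁻¹
  rational-form-ℚ⟦z⟧⟦u⟧ =
    let rV≡ = *-≡ r≡ V≡
        F≡  = *-≡ two≡ (*-≡ (+-≡ two≡ rV≡) (⁻¹-≡ d≡))
        F/P≡ = *-≡ F≡ (⁻¹-≡ (-‿≡ one≡ rV≡))
    in subst (λ f → g Szu.≈ f) F/P≡ rational-form
    where
    one≡ : Szu.1# ≡ B.1#
    one≡ = refl
    two≡ : Szu.κ SzA.two ≡ B.κ (S.κ (+ 2 / 1))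
    two≡ = refl
    r≡ : Szu.κ r ≡ B.κ (S.κ (+ 2 / 3) S.* (S.1# S.- t ∘z³) S.⁻¹)
    r≡ = refl
    V≡ : V ≡ B.X B.* B.κ S.X
    V≡ = refl
    d≡ : Szu.κ d ≡ B.κ ((S.1# S.- S.κ (+ 3 / 1) S.* t ∘z³) S.* (S.κ (+ 4 / 1) S.- S.κ (+ 3 / 1) S.* t ∘z³))
    d≡ = refl

-- Binomial coefficients, and arithmetic and sums in ℚ.

open ≡-Reasoning

private
  module ℚ^ = SemiringExp (CommutativeRing.semiring ℚ.+-*-commutativeRing)
open ℚ^ using (_^_)
open +-*-Solver using (solve; con; _:=_; _:+_; _:*_)

absorption : ∀ n k → suc k ℕ.* (suc n C suc k) ≡ suc n ℕ.* (n C k)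
absorption zero    zero    = refl
absorption zero    (suc k) = ℕ.*-zeroʳ (2 ℕ.+ k)
absorption (suc n) zero    = trans (ℕ.*-identityˡ _) (trans (nC1≡n (2 ℕ.+ n)) (sym (ℕ.*-identityʳ (2 ℕ.+ n))))
absorption (suc n) (suc k) = begin
  (2 ℕ.+ k) ℕ.* ((2 ℕ.+ n) C (2 ℕ.+ k))
    ≡⟨ cong ((2 ℕ.+ k) ℕ.*_) (nCk+nC[k+1]≡[n+1]C[k+1] (suc n) (suc k)) ⟨
  (2 ℕ.+ k) ℕ.* (c ℕ.+ (suc n C (2 ℕ.+ k)))
    ≡⟨ ℕ.*-distribˡ-+ (2 ℕ.+ k) c (suc n C (2 ℕ.+ k)) ⟩
  c ℕ.+ suc k ℕ.* c ℕ.+ (2 ℕ.+ k) ℕ.* (suc n C (2 ℕ.+ k))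
    ≡⟨ cong₂ (λ a b → c ℕ.+ a ℕ.+ b) (absorption n k) (absorption n (suc k)) ⟩
  c ℕ.+ suc n ℕ.* (n C k) ℕ.+ suc n ℕ.* (n C suc k)
    ≡⟨ ℕ.+-assoc c (suc n ℕ.* (n C k)) (suc n ℕ.* (n C suc k)) ⟩
  c ℕ.+ (suc n ℕ.* (n C k) ℕ.+ suc n ℕ.* (n C suc k))
    ≡⟨ cong (c ℕ.+_) (ℕ.*-distribˡ-+ (suc n) (n C k) (n C suc k)) ⟨
  c ℕ.+ suc n ℕ.* ((n C k) ℕ.+ (n C suc k))
    ≡⟨ cong (λ a → c ℕ.+ suc n ℕ.* a) (nCk+nC[k+1]≡[n+1]C[k+1] n k) ⟩
  (2 ℕ.+ n) ℕ.* c ∎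
  where c = suc n C suc k

-- The absorption factor (3k+3)/(k+1) is the constant 3; Pascal's rule then leaves the factor 2 for
-- row 3k+2.
[3k+3]C[k+1] : ∀ k → (3 ℕ.+ 3 ℕ.* k) C suc k ≡ 3 ℕ.* ((2 ℕ.+ 3 ℕ.* k) C k)
[3k+3]C[k+1] k = ℕ.*-cancelˡ-≡ _ _ (suc k) (begin
  suc k ℕ.* ((3 ℕ.+ 3 ℕ.* k) C suc k)      ≡⟨ absorption (2 ℕ.+ 3 ℕ.* k) k ⟩
  (3 ℕ.+ 3 ℕ.* k) ℕ.* c                    ≡⟨ lemma k c ⟩
  suc k ℕ.* (3 ℕ.* c)                      ∎)
  where
  c = (2 ℕ.+ 3 ℕ.* k) C k
  lemma : ∀ k c → (3 ℕ.+ 3 ℕ.* k) ℕ.* c ≡ suc k ℕ.* (3 ℕ.* c)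
  lemma = solve-∀

[3k+2]C[k+1] : ∀ k → (2 ℕ.+ 3 ℕ.* k) C suc k ≡ 2 ℕ.* ((2 ℕ.+ 3 ℕ.* k) C k)
[3k+2]C[k+1] k = ℕ.+-cancelˡ-≡ ((2 ℕ.+ 3 ℕ.* k) C k) _ _
  (trans (nCk+nC[k+1]≡[n+1]C[k+1] (2 ℕ.+ 3 ℕ.* k) k) ([3k+3]C[k+1] k))

fromℕ : ℕ → ℚ
fromℕ n = + n / 1

fromℚᵘ-+ : ∀ a b → fromℚᵘ (a ℚᵘ.+ b) ≡ fromℚᵘ a ⊕ fromℚᵘ b
fromℚᵘ-+ a b = ℚ.toℚᵘ-injective (ℚᵘ.≃-trans (ℚ.toℚᵘ-fromℚᵘ (a ℚᵘ.+ b)) (ℚᵘ.≃-sym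
  (ℚᵘ.≃-trans (ℚ.toℚᵘ-homo-+ (fromℚᵘ a) (fromℚᵘ b)) (ℚᵘ.+-cong (ℚ.toℚᵘ-fromℚᵘ a) (ℚ.toℚᵘ-fromℚᵘ b)))))

fromℚᵘ-* : ∀ a b → fromℚᵘ (a ℚᵘ.* b) ≡ fromℚᵘ a · fromℚᵘ b
fromℚᵘ-* a b = ℚ.toℚᵘ-injective (ℚᵘ.≃-trans (ℚ.toℚᵘ-fromℚᵘ (a ℚᵘ.* b)) (ℚᵘ.≃-sym
  (ℚᵘ.≃-trans (ℚ.toℚᵘ-homo-* (fromℚᵘ a) (fromℚᵘ b)) (ℚᵘ.*-cong (ℚ.toℚᵘ-fromℚᵘ a) (ℚ.toℚᵘ-fromℚᵘ b)))))

/-* : ∀ i m j n .{{_ : ℕ.NonZero m}} .{{_ : ℕ.NonZero n}} .{{_ : ℕ.NonZero (m ℕ.* n)}} →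
      (i ℤ.* j) / (m ℕ.* n) ≡ (i / m) · (j / n)
/-* i (suc m) j (suc n) = fromℚᵘ-* (ℚᵘ.mkℚᵘ i m) (ℚᵘ.mkℚᵘ j n)

fromℕ-+ : ∀ m n → fromℕ (m ℕ.+ n) ≡ fromℕ m ⊕ fromℕ n
fromℕ-+ m n = trans (cong (_/ 1) (sym (cong₂ ℤ._+_ (ℤ.*-identityʳ (+ m)) (ℤ.*-identityʳ (+ n)))))
  (fromℚᵘ-+ (ℚᵘ.mkℚᵘ (+ m) 0) (ℚᵘ.mkℚᵘ (+ n) 0))

fromℕ-* : ∀ m n → fromℕ (m ℕ.* n) ≡ fromℕ m · fromℕ n
fromℕ-* m n = trans (cong (_/ 1) (ℤ.pos-* m n)) (/-* (+ m) 1 (+ n) 1)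

2^/3^-sucˡ : ∀ a b → 2^ suc a /3^ b ≡ (+ 2 / 1) · 2^ a /3^ b
2^/3^-sucˡ a b = trans
  (ℚ./-cong {{ℕ.m^n≢0 3 b}} {{ℕ.m*n≢0 1 (3 ℕ.^ b) {{_}} {{ℕ.m^n≢0 3 b}}}} (ℤ.pos-* 2 (2 ℕ.^ a)) (sym (ℕ.*-identityˡ (3 ℕ.^ b))))
  (/-* (+ 2) 1 (+ (2 ℕ.^ a)) (3 ℕ.^ b) {{_}} {{ℕ.m^n≢0 3 b}} {{ℕ.m*n≢0 1 (3 ℕ.^ b) {{_}} {{ℕ.m^n≢0 3 b}}}})

2^/3^-sucʳ : ∀ a b → 2^ a /3^ suc b ≡ q · 2^ a /3^ b
2^/3^-sucʳ a b = trans
  (ℚ./-cong {{ℕ.m^n≢0 3 (suc b)}} {{ℕ.m^n≢0 3 (suc b)}} (sym (ℤ.*-identityˡ (+ (2 ℕ.^ a)))) refl)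
  (/-* (+ 1) 3 (+ (2 ℕ.^ a)) (3 ℕ.^ b) {{_}} {{ℕ.m^n≢0 3 b}} {{ℕ.m^n≢0 3 (suc b)}})

∑-cong : ∀ n {f g : ℕ → ℚ} → (∀ k → f k ≡ g k) → ∑≤ n f ≡ ∑≤ n g
∑-cong zero    f≡g = cong (_⊕ 0ℚ) (f≡g 0)
∑-cong (suc n) f≡g = cong₂ _⊕_ (f≡g 0) (∑-cong n (f≡g ∘ suc))

∑-last : ∀ n f → ∑≤ (suc n) f ≡ ∑≤ n f ⊕ f (suc n)
∑-last zero    f = solve 2 (λ a b → a :+ (b :+ con 0ℚ) := a :+ con 0ℚ :+ b) refl (f 0) (f 1)
∑-last (suc n) f = trans (cong (f 0 ⊕_) (∑-last n (f ∘ suc))) (sym (ℚ.+-assoc (f 0) (∑≤ n (f ∘ suc)) (f (2 ℕ.+ n))))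

∑-linear : ∀ n a f g → ∑[ k ≤ n ] (f k ⊕ a · g k) ≡ ∑≤ n f ⊕ a · ∑≤ n g
∑-linear zero    a f g = solve 3 (λ x a y → x :+ a :* y :+ con 0ℚ := x :+ con 0ℚ :+ a :* (y :+ con 0ℚ)) refl (f 0) a (g 0)
∑-linear (suc n) a f g = trans (cong (f 0 ⊕ a · g 0 ⊕_) (∑-linear n a (f ∘ suc) (g ∘ suc)))
  (solve 5 (λ x a y s t → x :+ a :* y :+ (s :+ a :* t) := x :+ s :+ a :* (y :+ t)) refl (f 0) a (g 0) (∑≤ n (f ∘ suc)) (∑≤ n (g ∘ suc)))

∑-scale : ∀ n a f → ∑[ k ≤ n ] (a · f k) ≡ a · ∑≤ n f
∑-scale zero    a f = solve 2 (λ a x → a :* x :+ con 0ℚ := a :* (x :+ con 0ℚ)) refl a (f 0)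
∑-scale (suc n) a f = trans (cong (a · f 0 ⊕_) (∑-scale n a (f ∘ suc))) (sym (ℚ.*-distribˡ-+ a (f 0) (∑≤ n (f ∘ suc))))

-- The binomial sums U.

-- This is p²/q. When `g (suc j) (suc j + 3N)` is normalised by pʲ q²ᴺ, the contribution from two
-- states above comes from N - 1 and carries q p³ q⁻² relative to pʲ q²ᴺ at the previous state's j,
-- that is y after dividing by p.
y : ℚ
y = + 4 / 3

U : ℕ → ℕ → ℚ
U m n = ∑[ i ≤ n ] (y ^ i · fromℕ ((m ℕ.+ i) C i))

U-pascal : ∀ m n → U (suc m) (suc n) ≡ U m (suc n) ⊕ y · U (suc m) n
U-pascal m n = begin
  -- The term i = 0 is the same in `U (suc m)` and `U m`, so Pascal's rule is applied from i = 1 on.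
  1ℚ · fromℕ 1 ⊕ ∑[ i ≤ n ] (y ^ suc i · fromℕ ((suc m ℕ.+ suc i) C suc i))
    ≡⟨ cong (1ℚ · fromℕ 1 ⊕_) (∑-cong n term) ⟩
  1ℚ · fromℕ 1 ⊕ ∑[ i ≤ n ] (y ^ suc i · fromℕ ((m ℕ.+ suc i) C suc i) ⊕ y · (y ^ i · fromℕ ((suc m ℕ.+ i) C i)))
    ≡⟨ cong (1ℚ · fromℕ 1 ⊕_) (∑-linear n y (λ i → y ^ suc i · fromℕ ((m ℕ.+ suc i) C suc i)) (λ i → y ^ i · fromℕ ((suc m ℕ.+ i) C i))) ⟩
  1ℚ · fromℕ 1 ⊕ (∑[ i ≤ n ] (y ^ suc i · fromℕ ((m ℕ.+ suc i) C suc i)) ⊕ y · U (suc m) n)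
    ≡⟨ ℚ.+-assoc (1ℚ · fromℕ 1) (∑[ i ≤ n ] (y ^ suc i · fromℕ ((m ℕ.+ suc i) C suc i))) (y · U (suc m) n) ⟨
  U m (suc n) ⊕ y · U (suc m) n ∎
  where
  term : ∀ i → y ^ suc i · fromℕ ((suc m ℕ.+ suc i) C suc i)
             ≡ y ^ suc i · fromℕ ((m ℕ.+ suc i) C suc i) ⊕ y · (y ^ i · fromℕ ((suc m ℕ.+ i) C i))
  term i = begin
    y ^ suc i · fromℕ (suc (m ℕ.+ suc i) C suc i)
      ≡⟨ cong (λ c → y ^ suc i · fromℕ c) (nCk+nC[k+1]≡[n+1]C[k+1] (m ℕ.+ suc i) i) ⟨
    y ^ suc i · fromℕ ((m ℕ.+ suc i) C i ℕ.+ b)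
      ≡⟨ cong (y ^ suc i ·_) (fromℕ-+ ((m ℕ.+ suc i) C i) b) ⟩
    y ^ suc i · (fromℕ ((m ℕ.+ suc i) C i) ⊕ fromℕ b)
      ≡⟨ cong (λ k → y ^ suc i · (fromℕ (k C i) ⊕ fromℕ b)) (ℕ.+-suc m i) ⟩
    y · y ^ i · (fromℕ ((suc m ℕ.+ i) C i) ⊕ fromℕ b)
      ≡⟨ solve 4 (λ y w a b → y :* w :* (a :+ b) := y :* w :* b :+ y :* (w :* a)) refl y (y ^ i) (fromℕ ((suc m ℕ.+ i) C i)) (fromℕ b) ⟩
    y ^ suc i · fromℕ b ⊕ y · (y ^ i · fromℕ ((suc m ℕ.+ i) C i)) ∎
    where b = (m ℕ.+ suc i) C suc i

U-last : ∀ m n c → (m ℕ.+ suc n) C suc n ≡ c → U m (suc n) ≡ U m n ⊕ y ^ suc n · fromℕ c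
U-last m n _ refl = ∑-last n (λ i → y ^ i · fromℕ ((m ℕ.+ i) C i))

-- Pascal's rule and splitting off the last term express `u` in two ways, with top terms 2 w c and 3
-- w c. Three times the first minus twice the second cancels c, and the coefficient of `a` becomes 3
-- · (4/3) - 2 = 2.
U-boundary : ∀ n → U (2 ℕ.+ 2 ℕ.* n) (suc n) ≡ (+ 3 / 1) · U (1 ℕ.+ 2 ℕ.* n) n ⊕ (+ 2 / 1) · U (2 ℕ.+ 2 ℕ.* n) n
U-boundary n = begin
  u
    ≡⟨ solve 1 (λ u → u := con (+ 3 / 1) :* u :+ con (ℚ.- (+ 2 / 1)) :* u) refl u ⟩
  (+ 3 / 1) · u ⊕ (ℚ.- (+ 2 / 1)) · u
    ≡⟨ cong₂ (λ a b → (+ 3 / 1) · a ⊕ (ℚ.- (+ 2 / 1)) · b) u≡₁ u≡₂ ⟩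
  (+ 3 / 1) · (b ⊕ w · (fromℕ 2 · c) ⊕ y · a) ⊕ (ℚ.- (+ 2 / 1)) · (a ⊕ w · (fromℕ 3 · c))
    ≡⟨ solve 4 (λ a b w c → con (+ 3 / 1) :* (b :+ w :* (con (+ 2 / 1) :* c) :+ con (+ 4 / 3) :* a)
         :+ con (ℚ.- (+ 2 / 1)) :* (a :+ w :* (con (+ 3 / 1) :* c)) := con (+ 3 / 1) :* b :+ con (+ 2 / 1) :* a) refl a b w c ⟩
  (+ 3 / 1) · b ⊕ (+ 2 / 1) · a ∎
  where
  u = U (2 ℕ.+ 2 ℕ.* n) (suc n)
  a = U (2 ℕ.+ 2 ℕ.* n) n
  b = U (1 ℕ.+ 2 ℕ.* n) n
  w = y ^ suc n
  c = fromℕ ((2 ℕ.+ 3 ℕ.* n) C n)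

  index : ∀ n → 1 ℕ.+ 2 ℕ.* n ℕ.+ suc n ≡ 2 ℕ.+ 3 ℕ.* n
  index = solve-∀

  u≡₁ : u ≡ b ⊕ w · (fromℕ 2 · c) ⊕ y · a
  u≡₁ = trans (U-pascal (1 ℕ.+ 2 ℕ.* n) n) (cong (_⊕ y · a)
    (trans (U-last (1 ℕ.+ 2 ℕ.* n) n _ (trans (cong (_C suc n) (index n)) ([3k+2]C[k+1] n)))
           (cong (λ k → b ⊕ w · k) (fromℕ-* 2 ((2 ℕ.+ 3 ℕ.* n) C n)))))

  u≡₂ : u ≡ a ⊕ w · (fromℕ 3 · c)
  u≡₂ = trans (U-last (2 ℕ.+ 2 ℕ.* n) n _ (trans (cong (λ k → suc k C suc n) (index n)) ([3k+3]C[k+1] n)))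
    (cong (λ k → a ⊕ w · k) (fromℕ-* 3 ((2 ℕ.+ 3 ℕ.* n) C n)))

shift : ∀ m i n → i ℕ.+ m ℕ.* suc n ≡ m ℕ.+ (i ℕ.+ m ℕ.* n)
shift = solve-∀

-- Coefficients of the solution in terms of U.

module Values {g gβ} (isWalk : IsWalk g gβ) where

  mutual
    value-0 : ∀ N → g 0 (3 ℕ.* N) ≡ (q · q) ^ N · U (2 ℕ.* N) N
    value-0 zero    = start-0 isWalk
    value-0 (suc N) = begin
      g 0 (3 ℕ.* suc N)
        ≡⟨ cong (g 0) (shift 3 0 N) ⟩
      g 0 (3 ℕ.+ 3 ℕ.* N)
        ≡⟨ step-0 isWalk (2 ℕ.+ 3 ℕ.* N) ⟩
      gβ (2 ℕ.+ 3 ℕ.* N) ⊕ q · g 2 (2 ℕ.+ 3 ℕ.* N)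
        ≡⟨ cong₂ (λ a b → a ⊕ q · b) (trans (step-β isWalk (1 ℕ.+ 3 ℕ.* N)) (cong (q ·_) (value-suc 0 N))) (value-suc 1 N) ⟩
      q · (1ℚ · (w · b)) ⊕ q · (p · 1ℚ · (w · a))
        -- Extracting q² leaves 1/q = 3 and p/q = 2, the coefficients in `U-boundary`.
        ≡⟨ solve 3 (λ w a b → con q :* (con 1ℚ :* (w :* b)) :+ con q :* (con p :* con 1ℚ :* (w :* a))
             := con q :* con q :* w :* (con (+ 3 / 1) :* b :+ con (+ 2 / 1) :* a)) refl w a b ⟩
      (q · q) ^ suc N · ((+ 3 / 1) · b ⊕ (+ 2 / 1) · a)
        ≡⟨ cong ((q · q) ^ suc N ·_) (U-boundary N) ⟨
      (q · q) ^ suc N · U (2 ℕ.+ 2 ℕ.* N) (suc N)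
        ≡⟨ cong (λ m → (q · q) ^ suc N · U m (suc N)) (shift 2 0 N) ⟨
      (q · q) ^ suc N · U (2 ℕ.* suc N) (suc N) ∎
      where
      w = (q · q) ^ N
      a = U (2 ℕ.+ 2 ℕ.* N) N
      b = U (1 ℕ.+ 2 ℕ.* N) N

    -- Induction on N, then on the state: the contribution from below keeps N, the one from two
    -- states above lowers it by one. The exponent of p lags one behind the state because the step
    -- from 0 to 1 has weight 1.
    value-suc : ∀ j N → g (suc j) (suc j ℕ.+ 3 ℕ.* N) ≡ p ^ j · ((q · q) ^ N · U (suc j ℕ.+ 2 ℕ.* N) N)
    value-suc zero zero = trans (step-1 isWalk 0)
      (cong₂ (λ a b → a ⊕ q · b) (start-0 isWalk) (start-i isWalk 2))
    value-suc (suc j) zero = begin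
      g (2 ℕ.+ j) (suc (suc j ℕ.+ 0))
        ≡⟨ step-i isWalk j (suc j ℕ.+ 0) ⟩
      p · g (1 ℕ.+ j) (suc j ℕ.+ 0) ⊕ q · g (4 ℕ.+ j) (suc j ℕ.+ 0)
        ≡⟨ cong₂ (λ a b → p · a ⊕ q · b) (value-suc j 0)
             (walk-vanishes isWalk {4 ℕ.+ j} {suc j ℕ.+ 0} (s≤s (ℕ.≤-trans (ℕ.≤-reflexive (cong suc (ℕ.+-identityʳ j))) (ℕ.m≤n+m (suc j) 2)))) ⟩
      p · (p ^ j · (1ℚ · U (suc j ℕ.+ 0) 0)) ⊕ q · 0ℚ
        ≡⟨ solve 2 (λ v u → con p :* (v :* (con 1ℚ :* u)) :+ con q :* con 0ℚ := con p :* v :* (con 1ℚ :* u)) refl (p ^ j) (U (suc j ℕ.+ 0) 0) ⟩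
      p ^ suc j · (1ℚ · U (2 ℕ.+ j ℕ.+ 0) 0) ∎
    value-suc zero (suc N) = begin
      g 1 (1 ℕ.+ 3 ℕ.* suc N)
        ≡⟨ step-1 isWalk (3 ℕ.* suc N) ⟩
      g 0 (3 ℕ.* suc N) ⊕ q · g 3 (3 ℕ.* suc N)
        ≡⟨ cong₂ (λ a b → a ⊕ q · b) (value-0 (suc N)) (trans (cong (g 3) (shift 3 0 N)) (value-suc 2 N)) ⟩
      q · q · w · U (2 ℕ.* suc N) (suc N) ⊕ q · (p · (p · 1ℚ) · (w · b))
        ≡⟨ solve 3 (λ w a b → con q :* con q :* w :* a :+ con q :* (con p :* (con p :* con 1ℚ) :* (w :* b))
             := con 1ℚ :* (con q :* con q :* w :* (a :+ con y :* b))) refl w (U (2 ℕ.* suc N) (suc N)) b ⟩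
      1ℚ · (q · q · w · (U (2 ℕ.* suc N) (suc N) ⊕ y · b))
        ≡⟨ cong (λ m → 1ℚ · (q · q · w · (U (2 ℕ.* suc N) (suc N) ⊕ y · U (suc m) N))) (shift 2 0 N) ⟨
      1ℚ · (q · q · w · (U (2 ℕ.* suc N) (suc N) ⊕ y · U (1 ℕ.+ 2 ℕ.* suc N) N))
        ≡⟨ cong (λ u → 1ℚ · (q · q · w · u)) (U-pascal (2 ℕ.* suc N) N) ⟨
      1ℚ · (q · q · w · U (1 ℕ.+ 2 ℕ.* suc N) (suc N)) ∎
      where
      w = (q · q) ^ N
      b = U (3 ℕ.+ 2 ℕ.* N) N
    value-suc (suc j) (suc N) = begin
      g (2 ℕ.+ j) (2 ℕ.+ j ℕ.+ 3 ℕ.* suc N)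
        ≡⟨ step-i isWalk j (suc j ℕ.+ 3 ℕ.* suc N) ⟩
      p · g (1 ℕ.+ j) (suc j ℕ.+ 3 ℕ.* suc N) ⊕ q · g (4 ℕ.+ j) (suc j ℕ.+ 3 ℕ.* suc N)
        ≡⟨ cong₂ (λ a b → p · a ⊕ q · b) (value-suc j (suc N))
             (trans (cong (g (4 ℕ.+ j)) (shift 3 (suc j) N)) (value-suc (3 ℕ.+ j) N)) ⟩
      p · (v · (q · q · w · a)) ⊕ q · (p · (p · (p · v)) · (w · U (4 ℕ.+ j ℕ.+ 2 ℕ.* N) N))
        ≡⟨ solve 4 (λ v w a b → con p :* (v :* (con q :* con q :* w :* a)) :+ con q :* (con p :* (con p :* (con p :* v)) :* (w :* b))
             := con p :* v :* (con q :* con q :* w :* (a :+ con y :* b))) refl v w a (U (4 ℕ.+ j ℕ.+ 2 ℕ.* N) N) ⟩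
      p · v · (q · q · w · (a ⊕ y · U (4 ℕ.+ j ℕ.+ 2 ℕ.* N) N))
        ≡⟨ cong (λ m → p · v · (q · q · w · (a ⊕ y · U (suc m) N))) (shift 2 (suc j) N) ⟨
      p · v · (q · q · w · (a ⊕ y · U (2 ℕ.+ j ℕ.+ 2 ℕ.* suc N) N))
        ≡⟨ cong (λ u → p · v · (q · q · w · u)) (U-pascal (suc j ℕ.+ 2 ℕ.* suc N) N) ⟨
      p · v · (q · q · w · U (2 ℕ.+ j ℕ.+ 2 ℕ.* suc N) (suc N)) ∎
      where
      v = p ^ j
      w = (q · q) ^ N
      a = U (suc j ℕ.+ 2 ℕ.* suc N) (suc N)

-- From U to the explicit sums.

2^/3^-y : ∀ i a b → 2^ (2 ℕ.* i ℕ.+ a) /3^ (b ℕ.+ i) ≡ 2^ a /3^ b · y ^ i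
2^/3^-y zero    a b = trans (cong (2^ a /3^_) (ℕ.+-identityʳ b)) (sym (ℚ.*-identityʳ (2^ a /3^ b)))
2^/3^-y (suc i) a b = begin
  2^ (2 ℕ.* suc i ℕ.+ a) /3^ (b ℕ.+ suc i)
    ≡⟨ cong₂ 2^_/3^_ (cong (ℕ._+ a) (shift 2 0 i)) (ℕ.+-suc b i) ⟩
  2^ (2 ℕ.+ 2 ℕ.* i ℕ.+ a) /3^ (suc (b ℕ.+ i))
    ≡⟨ trans (2^/3^-sucˡ (suc c) (suc d)) (cong ((+ 2 / 1) ·_) (trans (2^/3^-sucˡ c (suc d)) (cong ((+ 2 / 1) ·_) (2^/3^-sucʳ c d)))) ⟩
  (+ 2 / 1) · ((+ 2 / 1) · (q · 2^ (2 ℕ.* i ℕ.+ a) /3^ (b ℕ.+ i)))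
    ≡⟨ cong (λ x → (+ 2 / 1) · ((+ 2 / 1) · (q · x))) (2^/3^-y i a b) ⟩
  (+ 2 / 1) · ((+ 2 / 1) · (q · (2^ a /3^ b · y ^ i)))
    ≡⟨ solve 2 (λ x v → con (+ 2 / 1) :* (con (+ 2 / 1) :* (con q :* (x :* v))) := x :* (con y :* v)) refl (2^ a /3^ b) (y ^ i) ⟩
  2^ a /3^ b · y ^ suc i ∎
  where
  c = 2 ℕ.* i ℕ.+ a
  d = b ℕ.+ i

2^/3^-powers : ∀ j N → 2^ j /3^ (j ℕ.+ 2 ℕ.* N) ≡ p ^ j · (q · q) ^ N
2^/3^-powers zero    zero    = refl
2^/3^-powers zero    (suc N) = begin
  2^ 0 /3^ (2 ℕ.* suc N)
    ≡⟨ cong (2^ 0 /3^_) (shift 2 0 N) ⟩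
  2^ 0 /3^ (2 ℕ.+ 2 ℕ.* N)
    ≡⟨ trans (2^/3^-sucʳ 0 (1 ℕ.+ 2 ℕ.* N)) (cong (q ·_) (trans (2^/3^-sucʳ 0 (2 ℕ.* N)) (cong (q ·_) (2^/3^-powers zero N)))) ⟩
  q · (q · (1ℚ · (q · q) ^ N))
    ≡⟨ solve 1 (λ v → con q :* (con q :* (con 1ℚ :* v)) := con 1ℚ :* (con q :* con q :* v)) refl ((q · q) ^ N) ⟩
  1ℚ · (q · q) ^ suc N ∎
2^/3^-powers (suc j) N = begin
  2^ suc j /3^ (suc j ℕ.+ 2 ℕ.* N)
    ≡⟨ trans (2^/3^-sucˡ j (suc j ℕ.+ 2 ℕ.* N)) (cong ((+ 2 / 1) ·_) (trans (2^/3^-sucʳ j (j ℕ.+ 2 ℕ.* N)) (cong (q ·_) (2^/3^-powers j N)))) ⟩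
  (+ 2 / 1) · (q · (p ^ j · (q · q) ^ N))
    ≡⟨ solve 2 (λ u v → con (+ 2 / 1) :* (con q :* (u :* v)) := con p :* u :* v) refl (p ^ j) ((q · q) ^ N) ⟩
  p ^ suc j · (q · q) ^ N ∎


-- `f` is the summand as the claims spell it, with exponents in another order and truncated
-- subtractions, hence the pointwise hypothesis.
∑-U : ∀ N m a b (f : ℕ → ℚ) → (∀ i → f i ≡ 2^ (2 ℕ.* i ℕ.+ a) /3^ (b ℕ.+ i) · fromℕ ((m ℕ.+ i) C i)) →
      ∑≤ N f ≡ 2^ a /3^ b · U m N
∑-U N m a b f f≡ = trans (∑-cong N λ i → trans (f≡ i) (trans
    (cong (_· fromℕ ((m ℕ.+ i) C i)) (2^/3^-y i a b))
    (ℚ.*-assoc (2^ a /3^ b) (y ^ i) (fromℕ ((m ℕ.+ i) C i)))))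
  (∑-scale N (2^ a /3^ b) (λ i → y ^ i · fromℕ ((m ℕ.+ i) C i)))

module ClosedValues {g gβ} (isWalk : IsWalk g gβ) where
  open Values isWalk

  G-value : ∀ j N → 1 ≤ j → g j (j ℕ.+ 3 ℕ.* N) ≡
    ∑[ i ≤ N ] (2^ (2 ℕ.* i ℕ.+ j ℕ.∸ 1) /3^ (2 ℕ.* N ℕ.+ i ℕ.+ j ℕ.∸ 1) · fromℕ ((2 ℕ.* N ℕ.+ j ℕ.+ i) C i))
  G-value (suc j) N _ = begin
    g (suc j) (suc j ℕ.+ 3 ℕ.* N)
      ≡⟨ value-suc j N ⟩
    p ^ j · ((q · q) ^ N · U (suc j ℕ.+ 2 ℕ.* N) N)
      ≡⟨ ℚ.*-assoc (p ^ j) ((q · q) ^ N) (U (suc j ℕ.+ 2 ℕ.* N) N) ⟨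
    p ^ j · (q · q) ^ N · U (suc j ℕ.+ 2 ℕ.* N) N
      ≡⟨ cong (_· U (suc j ℕ.+ 2 ℕ.* N) N) (2^/3^-powers j N) ⟨
    2^ j /3^ (j ℕ.+ 2 ℕ.* N) · U (suc j ℕ.+ 2 ℕ.* N) N
      ≡⟨ ∑-U N (suc j ℕ.+ 2 ℕ.* N) j (j ℕ.+ 2 ℕ.* N)
           (λ i → 2^ (2 ℕ.* i ℕ.+ suc j ℕ.∸ 1) /3^ (2 ℕ.* N ℕ.+ i ℕ.+ suc j ℕ.∸ 1) · fromℕ ((2 ℕ.* N ℕ.+ suc j ℕ.+ i) C i))
           (λ i → cong₂ _·_
             -- With `suc j` in place of j, moving the `suc` to the front lets the truncated `∸ 1`
             -- cancel by computation.
             (cong₂ 2^_/3^_ (cong (ℕ._∸ 1) (ℕ.+-suc (2 ℕ.* i) j)) (cong (ℕ._∸ 1) (exponent (2 ℕ.* N) i j)))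
             (cong (λ m → fromℕ (m C i)) (upper (2 ℕ.* N) i j))) ⟨
    ∑[ i ≤ N ] (2^ (2 ℕ.* i ℕ.+ suc j ℕ.∸ 1) /3^ (2 ℕ.* N ℕ.+ i ℕ.+ suc j ℕ.∸ 1) · fromℕ ((2 ℕ.* N ℕ.+ suc j ℕ.+ i) C i)) ∎
    where
    exponent : ∀ k i j → k ℕ.+ i ℕ.+ suc j ≡ suc (j ℕ.+ k ℕ.+ i)
    exponent = solve-∀
    upper : ∀ k i j → k ℕ.+ suc j ℕ.+ i ≡ suc j ℕ.+ k ℕ.+ i
    upper = solve-∀

  g₀-value : ∀ N → g 0 (3 ℕ.* N) ≡ ∑[ i ≤ N ] (2^ (2 ℕ.* i) /3^ (2 ℕ.* N ℕ.+ i) · fromℕ ((2 ℕ.* N ℕ.+ i) C i))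
  g₀-value N = begin
    g 0 (3 ℕ.* N)
      ≡⟨ value-0 N ⟩
    (q · q) ^ N · U (2 ℕ.* N) N
      ≡⟨ cong (_· U (2 ℕ.* N) N) (trans (2^/3^-powers 0 N) (ℚ.*-identityˡ ((q · q) ^ N))) ⟨
    2^ 0 /3^ (2 ℕ.* N) · U (2 ℕ.* N) N
      ≡⟨ ∑-U N (2 ℕ.* N) 0 (2 ℕ.* N) (λ i → 2^ (2 ℕ.* i) /3^ (2 ℕ.* N ℕ.+ i) · fromℕ ((2 ℕ.* N ℕ.+ i) C i))
           (λ i → cong (λ a → 2^ a /3^ (2 ℕ.* N ℕ.+ i) · fromℕ ((2 ℕ.* N ℕ.+ i) C i)) (sym (ℕ.+-identityʳ (2 ℕ.* i)))) ⟨
    ∑[ i ≤ N ] (2^ (2 ℕ.* i) /3^ (2 ℕ.* N ℕ.+ i) · fromℕ ((2 ℕ.* N ℕ.+ i) C i)) ∎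

  gβ-g₁ : ∀ N → gβ (3 ℕ.* N ℕ.+ 2) ≡ q · g 1 (3 ℕ.* N ℕ.+ 1)
  gβ-g₁ N = trans (cong gβ (ℕ.+-suc (3 ℕ.* N) 1)) (step-β isWalk (3 ℕ.* N ℕ.+ 1))

  gβ-value : ∀ N → gβ (3 ℕ.* N ℕ.+ 2) ≡
    ∑[ i ≤ N ] (2^ (2 ℕ.* i) /3^ (2 ℕ.* N ℕ.+ i ℕ.+ 1) · fromℕ ((2 ℕ.* N ℕ.+ 1 ℕ.+ i) C i))
  gβ-value N = begin
    gβ (3 ℕ.* N ℕ.+ 2)
      ≡⟨ trans (gβ-g₁ N) (cong (q ·_) (trans (cong (g 1) (ℕ.+-comm (3 ℕ.* N) 1)) (value-suc 0 N))) ⟩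
    q · (1ℚ · ((q · q) ^ N · U (1 ℕ.+ 2 ℕ.* N) N))
      ≡⟨ solve 2 (λ v u → con q :* (con 1ℚ :* (v :* u)) := con q :* (con 1ℚ :* v) :* u) refl ((q · q) ^ N) (U (1 ℕ.+ 2 ℕ.* N) N) ⟩
    q · (1ℚ · (q · q) ^ N) · U (1 ℕ.+ 2 ℕ.* N) N
      ≡⟨ cong (_· U (1 ℕ.+ 2 ℕ.* N) N) (trans (2^/3^-sucʳ 0 (2 ℕ.* N)) (cong (q ·_) (2^/3^-powers 0 N))) ⟨
    2^ 0 /3^ (1 ℕ.+ 2 ℕ.* N) · U (1 ℕ.+ 2 ℕ.* N) N
      ≡⟨ ∑-U N (1 ℕ.+ 2 ℕ.* N) 0 (1 ℕ.+ 2 ℕ.* N) (λ i → 2^ (2 ℕ.* i) /3^ (2 ℕ.* N ℕ.+ i ℕ.+ 1) · fromℕ ((2 ℕ.* N ℕ.+ 1 ℕ.+ i) C i))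
           (λ i → cong₂ _·_ (cong₂ 2^_/3^_ (sym (ℕ.+-identityʳ (2 ℕ.* i))) (ℕ.+-comm (2 ℕ.* N ℕ.+ i) 1))
             (cong (λ m → fromℕ ((m ℕ.+ i) C i)) (ℕ.+-comm (2 ℕ.* N) 1))) ⟨
    ∑[ i ≤ N ] (2^ (2 ℕ.* i) /3^ (2 ℕ.* N ℕ.+ i ℕ.+ 1) · fromℕ ((2 ℕ.* N ℕ.+ 1 ℕ.+ i) C i)) ∎

open import Data.Nat.Base using (_+_; _*_)

theorem2 :
  -- the series g₀, g₁, … and g_β, and the series t, are well defined
  ∃! (Pointwise ℚ⟦z⟧⟦u⟧._≈_ ℚ⟦z⟧._≈_) (uncurry IsSolution)
  × ∃! ℚ⟦z⟧._≈_ IsT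
  × (∀ g gβ t → IsSolution g gβ → IsT t →
     let G = genFun g
         z = S.X
         V = B.X B.* B.κ z
         T = t ∘z³
         two = S.κ (+ 2 / 1)
         three = S.κ (+ 3 / 1)
         four = S.κ (+ 4 / 1)
         six = S.κ (+ 6 / 1)
         r = S.κ (+ 2 / 3) S.* (S.1# S.- T) S.⁻¹
         d = (S.1# S.- three S.* T) S.* (four S.- three S.* T)
     in
     -- (i)
     ( G B.≈ B.κ two B.* ((B.κ two B.+ B.κ r B.* V) B.* (B.κ d) B.⁻¹) B.* (B.1# B.- B.κ r B.* V) B.⁻¹
     × ∃ λ H → (G B.≈ H [V≔uz]) × (∀ j n → H j n ≢ 0ℚ → 3 ∣ n))
     -- (ii)
     × (∀ j → 1 ≤ j →
          (∀ H → G B.≈ H [V≔uz] → H j S.≈ six S.* d S.⁻¹ S.* r S.^ j)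
          × G j S.≈ z S.^ j S.* (six S.* d S.⁻¹ S.* r S.^ j))
     -- (iii)
     × (∀ j N → 1 ≤ j →
          G j (j + 3 * N)
          ≡ ∑[ i ≤ N ] (2^ (2 * i + j ∸ 1) /3^ (2 * N + i + j ∸ 1) · (+ ((2 * N + j + i) C i) / 1)))
     -- (iv)
     × (∀ N →
          g 0 (3 * N) ≡ ∑[ i ≤ N ] (2^ (2 * i) /3^ (2 * N + i) · (+ ((2 * N + i) C i) / 1))
          × gβ (3 * N + 2) ≡ (+ 1 / 3) · g 1 (3 * N + 1)
          × gβ (3 * N + 2) ≡ ∑[ i ≤ N ] (2^ (2 * i) /3^ (2 * N + i + 1) · (+ ((2 * N + 1 + i) C i) / 1))))
theorem2 = ∃!-solution , ∃!-t , λ g gβ t sol isT →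
  let open GeneratingFunction sol isT
      open ClosedValues (solution⇒walk sol)
  in (rational-form-ℚ⟦z⟧⟦u⟧ , in-powers-of-z³)
   , (λ where (suc j) _ → (λ H G≈H → coeffV-unique H G≈H (suc j)) , G≈z^j*coeffV (suc j))
   , G-value
   , λ N → g₀-value N , gβ-g₁ N , gβ-value N
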